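{- For every formula $P$ of the language of $\mathrm{Z}_{st}$: if $\mathrm{Z}_{st} \vdash P$, then $\mathrm{Z}_{mod} \vdash P^{\dagger}$.
   Context: All provability is in intuitionistic natural deduction. The theory $\mathrm{Z}_{st}$ is the first-order theory in the language with two binary predicate symbols $=$ and $\in$, with the following axioms. Abbreviations: $a\subseteq b \equiv \forall x(x\in a\Rightarrow x\in b)$; $\mathrm{Empty}(a)\equiv \forall x\,\neg(x\in a)$; $\mathrm{Succ}(a,b)\equiv\forall x(x\in b\Leftrightarrow(x\in a\lor x=a))$; $\mathrm{Ind}(c)\equiv \forall a(\mathrm{Empty}(a)\Rightarrow a\in c)\land\forall a(a\in c\Rightarrow\forall b(\mathrm{Succ}(a,b)\Rightarrow b\in c))$. Axioms: $\forall x\,(x=x)$; $\forall x\forall x'\forall y(x=x'\land x=y\Rightarrow x'=y)$; $\forall x\forall x'\forall y(x=x'\land x\in y\Rightarrow x'\in y)$; $\forall x\forall y\forall y'(y=y'\land x\in y\Rightarrow x\in y')$; Strong Extensionality: for each formula $R(x,y)$ with free variables among $x_1,\dots,x_n,x,y$, $\forall x_1\cdots\forall x_n\forall a\forall b\,(R(a,b)\land\forall x\forall x'\forall y(x'\in x\land R(x,y)\Rightarrow\exists y'(y'\in y\land R(x',y')))\land\forall y\forall y'\forall x(y'\in y\land R(x,y)\Rightarrow\exists x'(x'\in x\land R(x',y')))\Rightarrow a=b)$; Pairing $\forall a\forall b\exists e\forall x(x\in e\Leftrightarrow x=a\lor x=b)$; Union $\forall a\exists e\forall x(x\in e\Leftrightarrow\exists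 y(x\in y\land y\in a))$; Powerset $\forall a\exists e\forall x(x\in e\Leftrightarrow x\subseteq a)$; Restricted Comprehension: for each formula $P(x)$ with free variables among $x_1,\dots,x_n,a,x$, $\forall x_1\cdots\forall x_n\forall a\exists e\forall x(x\in e\Leftrightarrow x\in a\land P(x))$; Infinity $\exists e\,\mathrm{Ind}(e)$; Transitive Closure $\forall a\exists e(a\subseteq e\land\forall x\forall y(x\in y\land y\in e\Rightarrow x\in e))$. Deduction modulo: a theory is given by axioms and a congruence $\equiv$ on formulas generated by rewrite rules on terms and on atomic formulas (an atomic formula may rewrite to an arbitrary formula); every natural deduction rule is applied modulo $\equiv$ (e.g. from $C$ and $A$ infer $B$ whenever $C\equiv A\Rightarrow B$). The theory $\mathrm{Z}_{mod}$ is a many-sorted theory in deduction modulo with no axioms, only rewrite rules. Sorts: $G$ (pointed graphs), $N$ (nodes), $C$ (classes of nodes), $R$ (relations on nodes). Symbols: predicate $\eta$ of arity $(G,N,N)$, written $x\,\eta_a\,y$; $\mathrm{root}:G\to N$; $/:G\times N\to G$; predicate $=$ on $N\times N$; predicate $\mathrm{mem}$ on $N\times C$; predicate $\mathrm{rel}$ on $N\times N\times R$; for each formula $P$ with free variables among $x,y_1,\dots,y_n$ ($x$ of sort $N$) not containing any symbol $g_{\dots}$ or $g'_{\dots}$, a function symbol $g_{x,y_1,\dots,y_n,P}:N^n\to C$, and for each such $P$ with free variables among $x,x',y_1,\dots,y_n$ ($x,x'$ of sort $N$) a function symbol $g'_{x,x',y_1,\dots,y_n,P}:N^n\to R$; constants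 $o,0$ of sort $N$; functions $i,i',j,j',S,\mathrm{Pred}:N\to N$; unary predicates $I,J,\mathrm{Null},\mathrm{Nat}$ on $N$; binary predicate $<$ on $N$; $\rho:G\to N$; $\rho':N\to G$; predicates $\approx$ and $\in$ on $G\times G$; $\bigcup:G\to G$; $\{\_,\_\}:G\times G\to G$; $\mathcal P:G\to G$; constant $\Omega$ of sort $G$; $\mathrm{Cl}:G\to G$; and for each formula $P$ whose free variables $x,y_1,\dots,y_n$ are of sort $G$, built from the predicate symbols $\in,\approx$ with quantifiers over sort $G$ only, a function symbol $f_{x,y_1,\dots,y_n,P}:G^{n+1}\to G$. Rewrite rules: $x\,\eta_{a/z}\,y\to x\,\eta_a\,y$; $\mathrm{root}(a/x)\to x$; $(a/x)/y\to a/y$; $y=z\to\forall p\,(\mathrm{mem}(y,p)\Rightarrow\mathrm{mem}(z,p))$ ($p$ of sort $C$); $\mathrm{mem}(x,g_{x,y_1,\dots,y_n,P}(y_1,\dots,y_n))\to P$; $\mathrm{rel}(x,x',g'_{x,x',y_1,\dots,y_n,P}(y_1,\dots,y_n))\to P$; $i'(i(x))\to x$; $j'(j(x))\to x$; $\mathrm{Pred}(S(x))\to x$; $\rho'(\rho(x))\to x$; $I(i(x))\to\top$; $I(j(x))\to\bot$; $I(o)\to\bot$; $J(j(x))\to\top$; $J(i(x))\to\bot$; $J(o)\to\bot$; $\mathrm{Null}(0)\to\top$; $\mathrm{Null}(S(x))\to\bot$; $\mathrm{Nat}(0)\to\top$; $\mathrm{Nat}(S(x))\to\mathrm{Nat}(x)$;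 $x<0\to\bot$; $x<S(y)\to x<y\lor x=y$; $a\approx b\to\exists r\,(\mathrm{rel}(\mathrm{root}(a),\mathrm{root}(b),r)\land\forall x\forall x'\forall y(x'\,\eta_a\,x\land\mathrm{rel}(x,y,r)\Rightarrow\exists y'(y'\,\eta_b\,y\land\mathrm{rel}(x',y',r)))\land\forall y\forall y'\forall x(y'\,\eta_b\,y\land\mathrm{rel}(x,y,r)\Rightarrow\exists x'(x'\,\eta_a\,x\land\mathrm{rel}(x',y',r))))$ ($r$ of sort $R$); $a\in b\to\exists x\,(x\,\eta_b\,\mathrm{root}(b)\land a\approx(b/x))$; $\mathrm{root}(\bigcup(a))$, $\mathrm{root}(\{a,b\})$, $\mathrm{root}(\mathcal P(a))$, $\mathrm{root}(f_{x,y_1,\dots,y_n,P}(y_1,\dots,y_n,a))$, $\mathrm{root}(\Omega)$, $\mathrm{root}(\mathrm{Cl}(a))$ all $\to o$; $x\,\eta_{\bigcup(a)}\,x'\to\exists y\exists y'(x=i(y)\land x'=i(y')\land y\,\eta_a\,y')\lor\exists y\exists z(x=i(y)\land x'=o\land y\,\eta_a\,z\land z\,\eta_a\,\mathrm{root}(a))$; $x\,\eta_{\{a,b\}}\,x'\to\exists y\exists y'(x=i(y)\land x'=i(y')\land y\,\eta_a\,y')\lor\exists y\exists y'(x=j(y)\land x'=j(y')\land y\,\eta_b\,y')\lor(x=i(\mathrm{root}(a))\land x'=o)\lor(x=j(\mathrm{root}(b))\land x'=o)$; $x\,\eta_{\mathcal P(a)}\,x'\to\exists y\exists y'(x=i(y)\land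 x'=i(y')\land y\,\eta_a\,y')\lor\exists y\exists c(x=i(y)\land x'=j(\rho(c))\land y\,\eta_a\,\mathrm{root}(a)\land(a/y)\in c)\lor\exists c(x=j(\rho(c))\land x'=o)$ ($c$ of sort $G$); $x\,\eta_{f_{x,y_1,\dots,y_n,P}(y_1,\dots,y_n,a)}\,x'\to\exists y\exists y'(x=i(y)\land x'=i(y')\land y\,\eta_a\,y')\lor\exists y(x=i(y)\land x'=o\land y\,\eta_a\,\mathrm{root}(a)\land P(x\leftarrow a/y))$; $x\,\eta_\Omega\,x'\to\exists y\exists y'(x=i(y)\land x'=i(y')\land y<y')\lor\exists y(x=i(y)\land x'=o\land\mathrm{Nat}(y))$; $x\,\eta_{\mathrm{Cl}(a)}\,x'\to\exists y\exists y'(x=i(y)\land x'=i(y')\land y\,\eta_a\,y')\lor\exists y(x=i(y)\land x'=o\land\forall c[\forall z(z\,\eta_a\,\mathrm{root}(a)\Rightarrow\mathrm{mem}(z,c))\land\forall z\forall z'((z\,\eta_a\,z'\land\mathrm{mem}(z',c))\Rightarrow\mathrm{mem}(z,c))\Rightarrow\mathrm{mem}(y,c)])$ ($c$ of sort $C$). The translation $P\mapsto P^{\dagger}$ from formulas of $\mathrm{Z}_{st}$ to formulas of $\mathrm{Z}_{mod}$ makes all variables of sort $G$, replaces $=$ by $\approx$, keeps $\in$ as the $\in$ of $\mathrm{Z}_{mod}$, and preserves connectives and quantifiers. -}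

module Defs where

open import Data.Nat using (ℕ; zero; suc; _+_)
open import Data.Fin using (Fin; zero; suc; _↑ʳ_; _↑ˡ_)
open import Data.List using (List; []; _∷_; _++_; map; replicate)
open import Data.List.Membership.Propositional renaming (_∈_ to _∈ᴸ_)
open import Data.Product using (Σ; _,_)
open import Data.Bool using (Bool; true; false)
open import Relation.Binary.Construct.Closure.Equivalence using (EqClosure)

-- Part 1.  The first-order theory Z_st
-- Formulas with n free variables, de Bruijn indices (Fin n); the only
-- terms are variables.  zero is the most recently bound variable.

infixr 30 _∧ˢ_
infixr 25 _∨ˢ_
infixr 20 _⇒ˢ_
infix 40 _≐ˢ_ _∈ˢ_

data Fmˢ (n : ℕ) : Set where
  _≐ˢ_ _∈ˢ_ : Fin n → Fin n → Fmˢ n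
  ⊤ˢ ⊥ˢ     : Fmˢ n
  _∧ˢ_ _∨ˢ_ _⇒ˢ_ : Fmˢ n → Fmˢ n → Fmˢ n
  ∀ˢ ∃ˢ     : Fmˢ (suc n) → Fmˢ n

liftˢ : ∀ {n m} → (Fin n → Fin m) → Fin (suc n) → Fin (suc m)
liftˢ ρ zero    = zero
liftˢ ρ (suc k) = suc (ρ k)

renˢ : ∀ {n m} → (Fin n → Fin m) → Fmˢ n → Fmˢ m
renˢ ρ (x ≐ˢ y) = ρ x ≐ˢ ρ y
renˢ ρ (x ∈ˢ y) = ρ x ∈ˢ ρ y
renˢ ρ ⊤ˢ = ⊤ˢ
renˢ ρ ⊥ˢ = ⊥ˢ
renˢ ρ (A ∧ˢ B) = renˢ ρ A ∧ˢ renˢ ρ B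
renˢ ρ (A ∨ˢ B) = renˢ ρ A ∨ˢ renˢ ρ B
renˢ ρ (A ⇒ˢ B) = renˢ ρ A ⇒ˢ renˢ ρ B
renˢ ρ (∀ˢ A) = ∀ˢ (renˢ (liftˢ ρ) A)
renˢ ρ (∃ˢ A) = ∃ˢ (renˢ (liftˢ ρ) A)

sub0 : ∀ {n} → Fin n → Fin (suc n) → Fin n
sub0 y zero    = y
sub0 y (suc k) = k

_[_]ˢ : ∀ {n} → Fmˢ (suc n) → Fin n → Fmˢ n
A [ y ]ˢ = renˢ (sub0 y) A

x0 : ∀ {n} → Fin (suc n)
x0 = zero
x1 : ∀ {n} → Fin (suc (suc n))
x1 = suc zero
x2 : ∀ {n} → Fin (suc (suc (suc n)))
x2 = suc (suc zero)
x3 : ∀ {n} → Fin (suc (suc (suc (suc n))))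
x3 = suc (suc (suc zero))

¬ˢ_ : ∀ {n} → Fmˢ n → Fmˢ n
¬ˢ A = A ⇒ˢ ⊥ˢ

_⇔ˢ_ : ∀ {n} → Fmˢ n → Fmˢ n → Fmˢ n
A ⇔ˢ B = (A ⇒ˢ B) ∧ˢ (B ⇒ˢ A)

Subsetˢ : ∀ {n} → Fin n → Fin n → Fmˢ n
Subsetˢ a b = ∀ˢ (x0 ∈ˢ suc a ⇒ˢ x0 ∈ˢ suc b)

Emptyˢ : ∀ {n} → Fin n → Fmˢ n
Emptyˢ a = ∀ˢ (¬ˢ (x0 ∈ˢ suc a))

Succˢ : ∀ {n} → Fin n → Fin n → Fmˢ n
Succˢ a b = ∀ˢ (x0 ∈ˢ suc b ⇔ˢ (x0 ∈ˢ suc a ∨ˢ x0 ≐ˢ suc a))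

Indˢ : ∀ {n} → Fin n → Fmˢ n
Indˢ c = ∀ˢ (Emptyˢ x0 ⇒ˢ x0 ∈ˢ suc c)
      ∧ˢ ∀ˢ (x0 ∈ˢ suc c ⇒ˢ ∀ˢ (Succˢ x1 x0 ⇒ˢ x0 ∈ˢ suc (suc c)))

allsˢ : ∀ {n} (k : ℕ) → Fmˢ (k + n) → Fmˢ n
allsˢ zero    A = A
allsˢ (suc k) A = allsˢ k (∀ˢ A)

-- A schema formula R with free variables among (params p_1..p_k, x, y):
-- variable 0 is y (resp. x for comprehension), variable 1 is x (resp. a),
-- variables 2+i are the parameters.  Rapp R p u v = R(x := u, y := v).
appσ : ∀ {k m} → (Fin k → Fin m) → Fin m → Fin m → Fin (suc (suc k)) → Fin m
appσ p u v zero = v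
appσ p u v (suc zero) = u
appσ p u v (suc (suc l)) = p l

Rapp : ∀ {k m} → Fmˢ (suc (suc k)) → (Fin k → Fin m) → Fin m → Fin m → Fmˢ m
Rapp R p u v = renˢ (appσ p u v) R

-- parameters seen under d further binders
par : ∀ {k} (d : ℕ) → Fin k → Fin (d + (k + 0))
par d l = d ↑ʳ (l ↑ˡ 0)

SE : (k : ℕ) → Fmˢ (suc (suc k)) → Fmˢ 0
SE k R = allsˢ k (∀ˢ (∀ˢ
  ((Rapp R (par 2) x1 x0
     ∧ˢ ∀ˢ (∀ˢ (∀ˢ ((x1 ∈ˢ x2 ∧ˢ Rapp R (par 5) x2 x0)
                    ⇒ˢ ∃ˢ (x0 ∈ˢ x1 ∧ˢ Rapp R (par 6) x2 x0))))
     ∧ˢ ∀ˢ (∀ˢ (∀ˢ ((x1 ∈ˢ x2 ∧ˢ Rapp R (par 5) x0 x2)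
                    ⇒ˢ ∃ˢ (x0 ∈ˢ x1 ∧ˢ Rapp R (par 6) x0 x2)))))
   ⇒ˢ x1 ≐ˢ x0)))

-- Restricted comprehension instance for P (variable 0 = x, variable 1 = a)
Comp : (k : ℕ) → Fmˢ (suc (suc k)) → Fmˢ 0
Comp k P = allsˢ k (∀ˢ (∃ˢ (∀ˢ
  (x0 ∈ˢ x1 ⇔ˢ (x0 ∈ˢ x2 ∧ˢ Rapp P (par 3) x2 x0)))))

data Axiomˢ : Fmˢ 0 → Set where
  ax-refl    : Axiomˢ (∀ˢ (x0 ≐ˢ x0))
  ax-eqtrans : Axiomˢ (∀ˢ (∀ˢ (∀ˢ ((x2 ≐ˢ x1 ∧ˢ x2 ≐ˢ x0) ⇒ˢ x1 ≐ˢ x0))))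
  ax-memL    : Axiomˢ (∀ˢ (∀ˢ (∀ˢ ((x2 ≐ˢ x1 ∧ˢ x2 ∈ˢ x0) ⇒ˢ x1 ∈ˢ x0))))
  ax-memR    : Axiomˢ (∀ˢ (∀ˢ (∀ˢ ((x1 ≐ˢ x0 ∧ˢ x2 ∈ˢ x1) ⇒ˢ x2 ∈ˢ x0))))
  ax-ext     : (k : ℕ) (R : Fmˢ (suc (suc k))) → Axiomˢ (SE k R)
  ax-pair    : Axiomˢ (∀ˢ (∀ˢ (∃ˢ (∀ˢ (x0 ∈ˢ x1 ⇔ˢ (x0 ≐ˢ x3 ∨ˢ x0 ≐ˢ x2))))))
  ax-union   : Axiomˢ (∀ˢ (∃ˢ (∀ˢ (x0 ∈ˢ x1 ⇔ˢ ∃ˢ (x1 ∈ˢ x0 ∧ˢ x0 ∈ˢ x3)))))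
  ax-power   : Axiomˢ (∀ˢ (∃ˢ (∀ˢ (x0 ∈ˢ x1 ⇔ˢ Subsetˢ x0 x2))))
  ax-comp    : (k : ℕ) (P : Fmˢ (suc (suc k))) → Axiomˢ (Comp k P)
  ax-inf     : Axiomˢ (∃ˢ (Indˢ x0))
  ax-tc      : Axiomˢ (∀ˢ (∃ˢ (Subsetˢ x1 x0
                 ∧ˢ ∀ˢ (∀ˢ ((x1 ∈ˢ x0 ∧ˢ x0 ∈ˢ x2) ⇒ˢ x1 ∈ˢ x2)))))

from0 : ∀ {n} → Fin 0 → Fin n
from0 ()

infix 10 _⊢ˢ_
data _⊢ˢ_ : {n : ℕ} → List (Fmˢ n) → Fmˢ n → Set where
  hyp  : ∀ {n} {Hs : List (Fmˢ n)} {A} → A ∈ᴸ Hs → Hs ⊢ˢ A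
  ax   : ∀ {n} {Hs : List (Fmˢ n)} {A} → Axiomˢ A → Hs ⊢ˢ renˢ from0 A
  ⊤I   : ∀ {n} {Hs : List (Fmˢ n)} → Hs ⊢ˢ ⊤ˢ
  ⊥E   : ∀ {n} {Hs : List (Fmˢ n)} {A} → Hs ⊢ˢ ⊥ˢ → Hs ⊢ˢ A
  ∧I   : ∀ {n} {Hs : List (Fmˢ n)} {A B} → Hs ⊢ˢ A → Hs ⊢ˢ B → Hs ⊢ˢ A ∧ˢ B
  ∧E₁  : ∀ {n} {Hs : List (Fmˢ n)} {A B} → Hs ⊢ˢ A ∧ˢ B → Hs ⊢ˢ A
  ∧E₂  : ∀ {n} {Hs : List (Fmˢ n)} {A B} → Hs ⊢ˢ A ∧ˢ B → Hs ⊢ˢ B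
  ∨I₁  : ∀ {n} {Hs : List (Fmˢ n)} {A B} → Hs ⊢ˢ A → Hs ⊢ˢ A ∨ˢ B
  ∨I₂  : ∀ {n} {Hs : List (Fmˢ n)} {A B} → Hs ⊢ˢ B → Hs ⊢ˢ A ∨ˢ B
  ∨E   : ∀ {n} {Hs : List (Fmˢ n)} {A B D} → Hs ⊢ˢ A ∨ˢ B →
           (A ∷ Hs) ⊢ˢ D → (B ∷ Hs) ⊢ˢ D → Hs ⊢ˢ D
  ⇒I   : ∀ {n} {Hs : List (Fmˢ n)} {A B} → (A ∷ Hs) ⊢ˢ B → Hs ⊢ˢ A ⇒ˢ B
  ⇒E   : ∀ {n} {Hs : List (Fmˢ n)} {A B} → Hs ⊢ˢ A ⇒ˢ B → Hs ⊢ˢ A → Hs ⊢ˢ B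
  ∀I   : ∀ {n} {Hs : List (Fmˢ n)} {A} → map (renˢ suc) Hs ⊢ˢ A → Hs ⊢ˢ ∀ˢ A
  ∀E   : ∀ {n} {Hs : List (Fmˢ n)} {A} → Hs ⊢ˢ ∀ˢ A → (y : Fin n) → Hs ⊢ˢ A [ y ]ˢ
  ∃I   : ∀ {n} {Hs : List (Fmˢ n)} {A} (y : Fin n) → Hs ⊢ˢ A [ y ]ˢ → Hs ⊢ˢ ∃ˢ A
  ∃E   : ∀ {n} {Hs : List (Fmˢ n)} {A D} → Hs ⊢ˢ ∃ˢ A →
           (A ∷ map (renˢ suc) Hs) ⊢ˢ renˢ suc D → Hs ⊢ˢ D

-- Z_st ⊢ P : P (with its n free variables, plus possibly m further
-- fresh free variables available as terms) is derivable from no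
-- hypotheses (axioms are used through the rule ax).
ZstProves : ∀ {n} → Fmˢ n → Set
ZstProves {n} P = Σ ℕ λ m → [] ⊢ˢ renˢ (m ↑ʳ_) P

data Sort : Set where
  G N C R : Sort

Ctx : Set
Ctx = List Sort

infix 4 _∋_
data _∋_ : Ctx → Sort → Set where
  here  : ∀ {Γ s} → (s ∷ Γ) ∋ s
  there : ∀ {Γ s t} → Γ ∋ s → (t ∷ Γ) ∋ s

infixr 30 _∧_
infixr 25 _∨_
infixr 20 _⇒_
infix 40 _≐_ _≈_ _∈ᵍ_ _<ᵐ_
infixl 50 _/_
infixr 5 _,,_
infixr 60 ∀[_]_ ∃[_]_

-- Tm b Γ s : terms of sort s in context Γ.  The Bool b records whether
-- the symbols g_{...} / g'_{...} may occur (true) or not (false); the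
-- language of Z_mod is Tm true / Fm true, and the index formula P of g
-- and g' ranges over Fm false (formulas not containing g, g').
-- The index formula P of f_{x,y1..yn,P} (built from ∈, ≈ with quantifiers
-- over sort G only) is given as a Z_st formula with n+1 free variables
-- (variable 0 = x, variable 1+k = y_{k+1}); its Z_mod meaning is its
-- translation (tr below).
mutual
  data Tm : Bool → Ctx → Sort → Set where
    var   : ∀ {b Γ s} → Γ ∋ s → Tm b Γ s
    root  : ∀ {b Γ} → Tm b Γ G → Tm b Γ N
    _/_   : ∀ {b Γ} → Tm b Γ G → Tm b Γ N → Tm b Γ G
    g     : ∀ {Γ n} → Fm false (N ∷ replicate n N) → Tms true Γ (replicate n N) → Tm true Γ C
    g'    : ∀ {Γ n} → Fm false (N ∷ N ∷ replicate n N) → Tms true Γ (replicate n N) → Tm true Γ R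
    oᵐ 0ᵐ : ∀ {b Γ} → Tm b Γ N
    iᵐ i'ᵐ jᵐ j'ᵐ Sᵐ Predᵐ : ∀ {b Γ} → Tm b Γ N → Tm b Γ N
    ρ     : ∀ {b Γ} → Tm b Γ G → Tm b Γ N
    ρ'    : ∀ {b Γ} → Tm b Γ N → Tm b Γ G
    ⋃     : ∀ {b Γ} → Tm b Γ G → Tm b Γ G
    pair  : ∀ {b Γ} → Tm b Γ G → Tm b Γ G → Tm b Γ G
    𝒫     : ∀ {b Γ} → Tm b Γ G → Tm b Γ G
    Ω     : ∀ {b Γ} → Tm b Γ G
    Cl    : ∀ {b Γ} → Tm b Γ G → Tm b Γ G
    f     : ∀ {b Γ n} → Fmˢ (suc n) → Tms b Γ (replicate n G) → Tm b Γ G → Tm b Γ G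

  data Tms : Bool → Ctx → Ctx → Set where
    ε    : ∀ {b Γ} → Tms b Γ []
    _,,_ : ∀ {b Γ s Δ} → Tm b Γ s → Tms b Γ Δ → Tms b Γ (s ∷ Δ)

  data Fm : Bool → Ctx → Set where
    η     : ∀ {b Γ} → Tm b Γ G → Tm b Γ N → Tm b Γ N → Fm b Γ   -- η a x y  is  x η_a y
    _≐_   : ∀ {b Γ} → Tm b Γ N → Tm b Γ N → Fm b Γ
    mem   : ∀ {b Γ} → Tm b Γ N → Tm b Γ C → Fm b Γ
    rel   : ∀ {b Γ} → Tm b Γ N → Tm b Γ N → Tm b Γ R → Fm b Γ
    Iᵐ Jᵐ Nullᵐ Natᵐ : ∀ {b Γ} → Tm b Γ N → Fm b Γ
    _<ᵐ_  : ∀ {b Γ} → Tm b Γ N → Tm b Γ N → Fm b Γ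
    _≈_   : ∀ {b Γ} → Tm b Γ G → Tm b Γ G → Fm b Γ
    _∈ᵍ_  : ∀ {b Γ} → Tm b Γ G → Tm b Γ G → Fm b Γ
    ⊤ ⊥   : ∀ {b Γ} → Fm b Γ
    _∧_ _∨_ _⇒_ : ∀ {b Γ} → Fm b Γ → Fm b Γ → Fm b Γ
    ∀[_]_ ∃[_]_ : ∀ {b Γ} (s : Sort) → Fm b (s ∷ Γ) → Fm b Γ

Ren : Ctx → Ctx → Set
Ren Γ Δ = ∀ {s} → Γ ∋ s → Δ ∋ s

liftR : ∀ {Γ Δ t} → Ren Γ Δ → Ren (t ∷ Γ) (t ∷ Δ)
liftR σ here      = here
liftR σ (there x) = there (σ x)

mutual
  renT : ∀ {b Γ Δ s} → Ren Γ Δ → Tm b Γ s → Tm b Δ s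
  renT σ (var x) = var (σ x)
  renT σ (root a) = root (renT σ a)
  renT σ (a / x) = renT σ a / renT σ x
  renT σ (g P ys) = g P (renTs σ ys)
  renT σ (g' P ys) = g' P (renTs σ ys)
  renT σ oᵐ = oᵐ
  renT σ 0ᵐ = 0ᵐ
  renT σ (iᵐ x) = iᵐ (renT σ x)
  renT σ (i'ᵐ x) = i'ᵐ (renT σ x)
  renT σ (jᵐ x) = jᵐ (renT σ x)
  renT σ (j'ᵐ x) = j'ᵐ (renT σ x)
  renT σ (Sᵐ x) = Sᵐ (renT σ x)
  renT σ (Predᵐ x) = Predᵐ (renT σ x)
  renT σ (ρ a) = ρ (renT σ a)
  renT σ (ρ' x) = ρ' (renT σ x)
  renT σ (⋃ a) = ⋃ (renT σ a)
  renT σ (pair a c) = pair (renT σ a) (renT σ c)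
  renT σ (𝒫 a) = 𝒫 (renT σ a)
  renT σ Ω = Ω
  renT σ (Cl a) = Cl (renT σ a)
  renT σ (f P ys a) = f P (renTs σ ys) (renT σ a)

  renTs : ∀ {b Γ Δ Θ} → Ren Γ Δ → Tms b Γ Θ → Tms b Δ Θ
  renTs σ ε = ε
  renTs σ (t ,, ts) = renT σ t ,, renTs σ ts

  renF : ∀ {b Γ Δ} → Ren Γ Δ → Fm b Γ → Fm b Δ
  renF σ (η a x y) = η (renT σ a) (renT σ x) (renT σ y)
  renF σ (x ≐ y) = renT σ x ≐ renT σ y
  renF σ (mem x c) = mem (renT σ x) (renT σ c)
  renF σ (rel x y r) = rel (renT σ x) (renT σ y) (renT σ r)
  renF σ (Iᵐ x) = Iᵐ (renT σ x)
  renF σ (Jᵐ x) = Jᵐ (renT σ x)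
  renF σ (Nullᵐ x) = Nullᵐ (renT σ x)
  renF σ (Natᵐ x) = Natᵐ (renT σ x)
  renF σ (x <ᵐ y) = renT σ x <ᵐ renT σ y
  renF σ (a ≈ c) = renT σ a ≈ renT σ c
  renF σ (a ∈ᵍ c) = renT σ a ∈ᵍ renT σ c
  renF σ ⊤ = ⊤
  renF σ ⊥ = ⊥
  renF σ (A ∧ B) = renF σ A ∧ renF σ B
  renF σ (A ∨ B) = renF σ A ∨ renF σ B
  renF σ (A ⇒ B) = renF σ A ⇒ renF σ B
  renF σ (∀[ s ] A) = ∀[ s ] renF (liftR σ) A
  renF σ (∃[ s ] A) = ∃[ s ] renF (liftR σ) A

w1 : ∀ {b Γ s t} → Tm b Γ s → Tm b (t ∷ Γ) s
w1 = renT there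
w2 : ∀ {b Γ s t₁ t₂} → Tm b Γ s → Tm b (t₂ ∷ t₁ ∷ Γ) s
w2 a = w1 (w1 a)
w3 : ∀ {b Γ s t₁ t₂ t₃} → Tm b Γ s → Tm b (t₃ ∷ t₂ ∷ t₁ ∷ Γ) s
w3 a = w1 (w2 a)
w4 : ∀ {b Γ s t₁ t₂ t₃ t₄} → Tm b Γ s → Tm b (t₄ ∷ t₃ ∷ t₂ ∷ t₁ ∷ Γ) s
w4 a = w1 (w3 a)
w5 : ∀ {b Γ s t₁ t₂ t₃ t₄ t₅} → Tm b Γ s → Tm b (t₅ ∷ t₄ ∷ t₃ ∷ t₂ ∷ t₁ ∷ Γ) s
w5 a = w1 (w4 a)

v0 : ∀ {b Γ s} → Tm b (s ∷ Γ) s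
v0 = var here
v1 : ∀ {b Γ s t₀} → Tm b (t₀ ∷ s ∷ Γ) s
v1 = var (there here)
v2 : ∀ {b Γ s t₀ t₁} → Tm b (t₀ ∷ t₁ ∷ s ∷ Γ) s
v2 = var (there (there here))
v3 : ∀ {b Γ s t₀ t₁ t₂} → Tm b (t₀ ∷ t₁ ∷ t₂ ∷ s ∷ Γ) s
v3 = var (there (there (there here)))
v4 : ∀ {b Γ s t₀ t₁ t₂ t₃} → Tm b (t₀ ∷ t₁ ∷ t₂ ∷ t₃ ∷ s ∷ Γ) s
v4 = var (there (there (there (there here))))

Sub : Bool → Ctx → Ctx → Set
Sub b Γ Δ = ∀ {s} → Γ ∋ s → Tm b Δ s

liftS : ∀ {b Γ Δ t} → Sub b Γ Δ → Sub b (t ∷ Γ) (t ∷ Δ)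
liftS σ here      = var here
liftS σ (there x) = w1 (σ x)

mutual
  subT : ∀ {b Γ Δ s} → Sub b Γ Δ → Tm b Γ s → Tm b Δ s
  subT σ (var x) = σ x
  subT σ (root a) = root (subT σ a)
  subT σ (a / x) = subT σ a / subT σ x
  subT σ (g P ys) = g P (subTs σ ys)
  subT σ (g' P ys) = g' P (subTs σ ys)
  subT σ oᵐ = oᵐ
  subT σ 0ᵐ = 0ᵐ
  subT σ (iᵐ x) = iᵐ (subT σ x)
  subT σ (i'ᵐ x) = i'ᵐ (subT σ x)
  subT σ (jᵐ x) = jᵐ (subT σ x)
  subT σ (j'ᵐ x) = j'ᵐ (subT σ x)
  subT σ (Sᵐ x) = Sᵐ (subT σ x)
  subT σ (Predᵐ x) = Predᵐ (subT σ x)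
  subT σ (ρ a) = ρ (subT σ a)
  subT σ (ρ' x) = ρ' (subT σ x)
  subT σ (⋃ a) = ⋃ (subT σ a)
  subT σ (pair a c) = pair (subT σ a) (subT σ c)
  subT σ (𝒫 a) = 𝒫 (subT σ a)
  subT σ Ω = Ω
  subT σ (Cl a) = Cl (subT σ a)
  subT σ (f P ys a) = f P (subTs σ ys) (subT σ a)

  subTs : ∀ {b Γ Δ Θ} → Sub b Γ Δ → Tms b Γ Θ → Tms b Δ Θ
  subTs σ ε = ε
  subTs σ (t ,, ts) = subT σ t ,, subTs σ ts

  subF : ∀ {b Γ Δ} → Sub b Γ Δ → Fm b Γ → Fm b Δ
  subF σ (η a x y) = η (subT σ a) (subT σ x) (subT σ y)
  subF σ (x ≐ y) = subT σ x ≐ subT σ y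
  subF σ (mem x c) = mem (subT σ x) (subT σ c)
  subF σ (rel x y r) = rel (subT σ x) (subT σ y) (subT σ r)
  subF σ (Iᵐ x) = Iᵐ (subT σ x)
  subF σ (Jᵐ x) = Jᵐ (subT σ x)
  subF σ (Nullᵐ x) = Nullᵐ (subT σ x)
  subF σ (Natᵐ x) = Natᵐ (subT σ x)
  subF σ (x <ᵐ y) = subT σ x <ᵐ subT σ y
  subF σ (a ≈ c) = subT σ a ≈ subT σ c
  subF σ (a ∈ᵍ c) = subT σ a ∈ᵍ subT σ c
  subF σ ⊤ = ⊤
  subF σ ⊥ = ⊥
  subF σ (A ∧ B) = subF σ A ∧ subF σ B
  subF σ (A ∨ B) = subF σ A ∨ subF σ B
  subF σ (A ⇒ B) = subF σ A ⇒ subF σ B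
  subF σ (∀[ s ] A) = ∀[ s ] subF (liftS σ) A
  subF σ (∃[ s ] A) = ∃[ s ] subF (liftS σ) A

_▸_ : ∀ {b Γ s} → Tm b Γ s → Sub b (s ∷ Γ) Γ
(t ▸ here) = t
(t ▸ there x) = var x

_[_] : ∀ {b Γ s} → Fm b (s ∷ Γ) → Tm b Γ s → Fm b Γ
A [ t ] = subF (t ▸_) A

mutual
  embT : ∀ {b Γ s} → Tm false Γ s → Tm b Γ s
  embT (var x) = var x
  embT (root a) = root (embT a)
  embT (a / x) = embT a / embT x
  embT oᵐ = oᵐ
  embT 0ᵐ = 0ᵐ
  embT (iᵐ x) = iᵐ (embT x)
  embT (i'ᵐ x) = i'ᵐ (embT x)
  embT (jᵐ x) = jᵐ (embT x)
  embT (j'ᵐ x) = j'ᵐ (embT x)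
  embT (Sᵐ x) = Sᵐ (embT x)
  embT (Predᵐ x) = Predᵐ (embT x)
  embT (ρ a) = ρ (embT a)
  embT (ρ' x) = ρ' (embT x)
  embT (⋃ a) = ⋃ (embT a)
  embT (pair a c) = pair (embT a) (embT c)
  embT (𝒫 a) = 𝒫 (embT a)
  embT Ω = Ω
  embT (Cl a) = Cl (embT a)
  embT (f P ys a) = f P (embTs ys) (embT a)

  embTs : ∀ {b Γ Θ} → Tms false Γ Θ → Tms b Γ Θ
  embTs ε = ε
  embTs (t ,, ts) = embT t ,, embTs ts

  embF : ∀ {b Γ} → Fm false Γ → Fm b Γ
  embF (η a x y) = η (embT a) (embT x) (embT y)
  embF (x ≐ y) = embT x ≐ embT y
  embF (mem x c) = mem (embT x) (embT c)
  embF (rel x y r) = rel (embT x) (embT y) (embT r)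
  embF (Iᵐ x) = Iᵐ (embT x)
  embF (Jᵐ x) = Jᵐ (embT x)
  embF (Nullᵐ x) = Nullᵐ (embT x)
  embF (Natᵐ x) = Natᵐ (embT x)
  embF (x <ᵐ y) = embT x <ᵐ embT y
  embF (a ≈ c) = embT a ≈ embT c
  embF (a ∈ᵍ c) = embT a ∈ᵍ embT c
  embF ⊤ = ⊤
  embF ⊥ = ⊥
  embF (A ∧ B) = embF A ∧ embF B
  embF (A ∨ B) = embF A ∨ embF B
  embF (A ⇒ B) = embF A ⇒ embF B
  embF (∀[ s ] A) = ∀[ s ] embF A
  embF (∃[ s ] A) = ∃[ s ] embF A

lookupTms : ∀ {b Γ Δ s} → Tms b Γ Δ → Δ ∋ s → Tm b Γ s
lookupTms (t ,, ts) here      = t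
lookupTms (t ,, ts) (there x) = lookupTms ts x

inst : ∀ {Γ Δ} → Fm false Δ → Tms true Γ Δ → Fm true Γ
inst P ts = subF (lookupTms ts) (embF P)

lookupG : ∀ {b Γ n} → Tms b Γ (replicate n G) → Fin n → Tm b Γ G
lookupG {n = suc n} (t ,, ts) zero    = t
lookupG {n = suc n} (t ,, ts) (suc k) = lookupG ts k

extG : ∀ {b Γ n} → (Fin n → Tm b Γ G) → Fin (suc n) → Tm b (G ∷ Γ) G
extG σ zero    = var here
extG σ (suc k) = w1 (σ k)

tr : ∀ {b Γ n} → Fmˢ n → (Fin n → Tm b Γ G) → Fm b Γ
tr (x ≐ˢ y) σ = σ x ≈ σ y
tr (x ∈ˢ y) σ = σ x ∈ᵍ σ y
tr ⊤ˢ σ = ⊤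
tr ⊥ˢ σ = ⊥
tr (A ∧ˢ B) σ = tr A σ ∧ tr B σ
tr (A ∨ˢ B) σ = tr A σ ∨ tr B σ
tr (A ⇒ˢ B) σ = tr A σ ⇒ tr B σ
tr (∀ˢ A) σ = ∀[ G ] tr A (extG σ)
tr (∃ˢ A) σ = ∃[ G ] tr A (extG σ)

finVar : ∀ {n} → Fin n → replicate n G ∋ G
finVar zero    = here
finVar (suc k) = there (finVar k)

_† : ∀ {n} → Fmˢ n → Fm true (replicate n G)
P † = tr P (λ k → var (finVar k))

infix 5 _↦ᵗ_ _↦ᵃ_ _⟶_
data _↦ᵗ_ {Γ : Ctx} : {s : Sort} → Tm true Γ s → Tm true Γ s → Set where
  t-root/  : ∀ {a x} → root (a / x) ↦ᵗ x
  t-//     : ∀ {a x y} → (a / x) / y ↦ᵗ a / y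
  t-i'i    : ∀ {x} → i'ᵐ (iᵐ x) ↦ᵗ x
  t-j'j    : ∀ {x} → j'ᵐ (jᵐ x) ↦ᵗ x
  t-PredS  : ∀ {x} → Predᵐ (Sᵐ x) ↦ᵗ x
  t-ρ'ρ    : ∀ {a} → ρ' (ρ a) ↦ᵗ a
  t-root⋃  : ∀ {a} → root (⋃ a) ↦ᵗ oᵐ
  t-rootpr : ∀ {a c} → root (pair a c) ↦ᵗ oᵐ
  t-root𝒫  : ∀ {a} → root (𝒫 a) ↦ᵗ oᵐ
  t-rootf  : ∀ {n} {P : Fmˢ (suc n)} {ys a} → root (f P ys a) ↦ᵗ oᵐ
  t-rootΩ  : root Ω ↦ᵗ oᵐ
  t-rootCl : ∀ {a} → root (Cl a) ↦ᵗ oᵐ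

common : ∀ {Γ} → Tm true Γ G → Tm true Γ N → Tm true Γ N → Fm true Γ
common a x x' = ∃[ N ] ∃[ N ] (w2 x ≐ iᵐ v1 ∧ w2 x' ≐ iᵐ v0 ∧ η (w2 a) v1 v0)

≈-body : ∀ {Γ} → Tm true Γ G → Tm true Γ G → Fm true Γ
≈-body a b = ∃[ R ] (rel (root (w1 a)) (root (w1 b)) v0
  ∧ (∀[ N ] ∀[ N ] ∀[ N ] ((η (w4 a) v1 v2 ∧ rel v2 v0 v3)
                         ⇒ ∃[ N ] (η (w5 b) v0 v1 ∧ rel v2 v0 v4)))
  ∧ (∀[ N ] ∀[ N ] ∀[ N ] ((η (w4 b) v1 v2 ∧ rel v0 v2 v3)
                         ⇒ ∃[ N ] (η (w5 a) v0 v1 ∧ rel v0 v2 v4))))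

fσ : ∀ {Γ n} → Tms true Γ (replicate n G) → Tm true Γ G → Fin (suc n) → Tm true (N ∷ Γ) G
fσ ys a zero    = w1 a / v0
fσ ys a (suc k) = w1 (lookupG ys k)

data _↦ᵃ_ {Γ : Ctx} : Fm true Γ → Fm true Γ → Set where
  a-η/   : ∀ {a z x y} → η (a / z) x y ↦ᵃ η a x y
  a-eq   : ∀ {y z} → y ≐ z ↦ᵃ ∀[ C ] (mem (w1 y) v0 ⇒ mem (w1 z) v0)
  a-g    : ∀ {n} {P : Fm false (N ∷ replicate n N)} {ys x} → mem x (g P ys) ↦ᵃ inst P (x ,, ys)
  a-g'   : ∀ {n} {P : Fm false (N ∷ N ∷ replicate n N)} {ys x x'} →
             rel x x' (g' P ys) ↦ᵃ inst P (x ,, x' ,, ys)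
  a-Ii   : ∀ {x} → Iᵐ (iᵐ x) ↦ᵃ ⊤
  a-Ij   : ∀ {x} → Iᵐ (jᵐ x) ↦ᵃ ⊥
  a-Io   : Iᵐ oᵐ ↦ᵃ ⊥
  a-Jj   : ∀ {x} → Jᵐ (jᵐ x) ↦ᵃ ⊤
  a-Ji   : ∀ {x} → Jᵐ (iᵐ x) ↦ᵃ ⊥
  a-Jo   : Jᵐ oᵐ ↦ᵃ ⊥
  a-Null0 : Nullᵐ 0ᵐ ↦ᵃ ⊤
  a-NullS : ∀ {x} → Nullᵐ (Sᵐ x) ↦ᵃ ⊥
  a-Nat0 : Natᵐ 0ᵐ ↦ᵃ ⊤
  a-NatS : ∀ {x} → Natᵐ (Sᵐ x) ↦ᵃ Natᵐ x
  a-<0   : ∀ {x} → x <ᵐ 0ᵐ ↦ᵃ ⊥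
  a-<S   : ∀ {x y} → x <ᵐ Sᵐ y ↦ᵃ (x <ᵐ y ∨ x ≐ y)
  a-≈    : ∀ {a b} → a ≈ b ↦ᵃ ≈-body a b
  a-∈    : ∀ {a b} → a ∈ᵍ b ↦ᵃ ∃[ N ] (η (w1 b) v0 (root (w1 b)) ∧ w1 a ≈ (w1 b / v0))
  a-η⋃   : ∀ {a x x'} → η (⋃ a) x x' ↦ᵃ
             (common a x x'
              ∨ ∃[ N ] ∃[ N ] (w2 x ≐ iᵐ v1 ∧ w2 x' ≐ oᵐ ∧ η (w2 a) v1 v0
                               ∧ η (w2 a) v0 (root (w2 a))))
  a-ηpair : ∀ {a b x x'} → η (pair a b) x x' ↦ᵃ
             (common a x x'
              ∨ (∃[ N ] ∃[ N ] (w2 x ≐ jᵐ v1 ∧ w2 x' ≐ jᵐ v0 ∧ η (w2 b) v1 v0))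
              ∨ (x ≐ iᵐ (root a) ∧ x' ≐ oᵐ)
              ∨ (x ≐ jᵐ (root b) ∧ x' ≐ oᵐ))
  a-η𝒫   : ∀ {a x x'} → η (𝒫 a) x x' ↦ᵃ
             (common a x x'
              ∨ (∃[ N ] ∃[ G ] (w2 x ≐ iᵐ v1 ∧ w2 x' ≐ jᵐ (ρ v0)
                               ∧ η (w2 a) v1 (root (w2 a)) ∧ (w2 a / v1) ∈ᵍ v0))
              ∨ ∃[ G ] (w1 x ≐ jᵐ (ρ v0) ∧ w1 x' ≐ oᵐ))
  a-ηf   : ∀ {n} {P : Fmˢ (suc n)} {ys a x x'} → η (f P ys a) x x' ↦ᵃ
             (common a x x'
              ∨ ∃[ N ] (w1 x ≐ iᵐ v0 ∧ w1 x' ≐ oᵐ ∧ η (w1 a) v0 (root (w1 a))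
                        ∧ tr P (fσ ys a)))
  a-ηΩ   : ∀ {x x'} → η Ω x x' ↦ᵃ
             ((∃[ N ] ∃[ N ] (w2 x ≐ iᵐ v1 ∧ w2 x' ≐ iᵐ v0 ∧ v1 <ᵐ v0))
              ∨ ∃[ N ] (w1 x ≐ iᵐ v0 ∧ w1 x' ≐ oᵐ ∧ Natᵐ v0))
  a-ηCl  : ∀ {a x x'} → η (Cl a) x x' ↦ᵃ
             (common a x x'
              ∨ ∃[ N ] (w1 x ≐ iᵐ v0 ∧ w1 x' ≐ oᵐ
                 ∧ ∀[ C ] (((∀[ N ] (η (w3 a) v0 (root (w3 a)) ⇒ mem v0 v1))
                            ∧ (∀[ N ] ∀[ N ] ((η (w4 a) v1 v0 ∧ mem v0 v2) ⇒ mem v1 v2)))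
                           ⇒ mem v1 v0)))

data _⟶_ : {Γ : Ctx} → Fm true Γ → Fm true Γ → Set where
  atom : ∀ {Γ} {A B : Fm true Γ} → A ↦ᵃ B → A ⟶ B
  term : ∀ {Γ s} (K : Fm true (s ∷ Γ)) {l r : Tm true Γ s} → l ↦ᵗ r → K [ l ] ⟶ K [ r ]
  ∧₁ : ∀ {Γ} {A A' B : Fm true Γ} → A ⟶ A' → (A ∧ B) ⟶ (A' ∧ B)
  ∧₂ : ∀ {Γ} {A B B' : Fm true Γ} → B ⟶ B' → (A ∧ B) ⟶ (A ∧ B')
  ∨₁ : ∀ {Γ} {A A' B : Fm true Γ} → A ⟶ A' → (A ∨ B) ⟶ (A' ∨ B)
  ∨₂ : ∀ {Γ} {A B B' : Fm true Γ} → B ⟶ B' → (A ∨ B) ⟶ (A ∨ B')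
  ⇒₁ : ∀ {Γ} {A A' B : Fm true Γ} → A ⟶ A' → (A ⇒ B) ⟶ (A' ⇒ B)
  ⇒₂ : ∀ {Γ} {A B B' : Fm true Γ} → B ⟶ B' → (A ⇒ B) ⟶ (A ⇒ B')
  ∀c : ∀ {Γ s} {A A' : Fm true (s ∷ Γ)} → A ⟶ A' → (∀[ s ] A) ⟶ (∀[ s ] A')
  ∃c : ∀ {Γ s} {A A' : Fm true (s ∷ Γ)} → A ⟶ A' → (∃[ s ] A) ⟶ (∃[ s ] A')

_≡ᵐ_ : ∀ {Γ} → Fm true Γ → Fm true Γ → Set
_≡ᵐ_ {Γ} = EqClosure (_⟶_ {Γ})

-- Intuitionistic natural deduction modulo ≡ᵐ (no axioms).  Applying every
-- rule modulo ≡ᵐ is presented, equivalently, by the conversion rule conv.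
infix 10 _⊢ᵐ_
data _⊢ᵐ_ : {Γ : Ctx} → List (Fm true Γ) → Fm true Γ → Set where
  hyp  : ∀ {Γ} {Hs : List (Fm true Γ)} {A} → A ∈ᴸ Hs → Hs ⊢ᵐ A
  conv : ∀ {Γ} {Hs : List (Fm true Γ)} {A B} → Hs ⊢ᵐ A → A ≡ᵐ B → Hs ⊢ᵐ B
  ⊤I   : ∀ {Γ} {Hs : List (Fm true Γ)} → Hs ⊢ᵐ ⊤
  ⊥E   : ∀ {Γ} {Hs : List (Fm true Γ)} {A} → Hs ⊢ᵐ ⊥ → Hs ⊢ᵐ A
  ∧I   : ∀ {Γ} {Hs : List (Fm true Γ)} {A B} → Hs ⊢ᵐ A → Hs ⊢ᵐ B → Hs ⊢ᵐ A ∧ B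
  ∧E₁  : ∀ {Γ} {Hs : List (Fm true Γ)} {A B} → Hs ⊢ᵐ A ∧ B → Hs ⊢ᵐ A
  ∧E₂  : ∀ {Γ} {Hs : List (Fm true Γ)} {A B} → Hs ⊢ᵐ A ∧ B → Hs ⊢ᵐ B
  ∨I₁  : ∀ {Γ} {Hs : List (Fm true Γ)} {A B} → Hs ⊢ᵐ A → Hs ⊢ᵐ A ∨ B
  ∨I₂  : ∀ {Γ} {Hs : List (Fm true Γ)} {A B} → Hs ⊢ᵐ B → Hs ⊢ᵐ A ∨ B
  ∨E   : ∀ {Γ} {Hs : List (Fm true Γ)} {A B D} → Hs ⊢ᵐ A ∨ B →
           (A ∷ Hs) ⊢ᵐ D → (B ∷ Hs) ⊢ᵐ D → Hs ⊢ᵐ D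
  ⇒I   : ∀ {Γ} {Hs : List (Fm true Γ)} {A B} → (A ∷ Hs) ⊢ᵐ B → Hs ⊢ᵐ A ⇒ B
  ⇒E   : ∀ {Γ} {Hs : List (Fm true Γ)} {A B} → Hs ⊢ᵐ A ⇒ B → Hs ⊢ᵐ A → Hs ⊢ᵐ B
  ∀I   : ∀ {Γ s} {Hs : List (Fm true Γ)} {A} → map (renF there) Hs ⊢ᵐ A → Hs ⊢ᵐ ∀[ s ] A
  ∀E   : ∀ {Γ s} {Hs : List (Fm true Γ)} {A} → Hs ⊢ᵐ ∀[ s ] A → (t : Tm true Γ s) → Hs ⊢ᵐ A [ t ]
  ∃I   : ∀ {Γ s} {Hs : List (Fm true Γ)} {A} (t : Tm true Γ s) → Hs ⊢ᵐ A [ t ] → Hs ⊢ᵐ ∃[ s ] A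
  ∃E   : ∀ {Γ s} {Hs : List (Fm true Γ)} {A D} → Hs ⊢ᵐ ∃[ s ] A →
           (A ∷ map (renF there) Hs) ⊢ᵐ renF there D → Hs ⊢ᵐ D

wkAll : ∀ {Γ} (Δ : Ctx) → Ren Γ (Δ ++ Γ)
wkAll []      x = x
wkAll (s ∷ Δ) x = there (wkAll Δ x)

-- Z_mod ⊢ A  (possibly using further fresh free variables of any sorts)
ZmodProves : ∀ {Γ} → Fm true Γ → Set
ZmodProves {Γ} A = Σ Ctx λ Δ → [] ⊢ᵐ renF (wkAll Δ) A

{-# OPTIONS --safe #-}
module Submission where

-- A bisimulation between a and b is usually assembled from other relations, but the
-- comprehension symbols of Z_mod do not accept parameters of sort R.  One always uses
-- instead a relation that mentions graphs only, such as "a / x ≈ b / y", which is itself a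
-- bisimulation.  Graph parameters are harmless because ρ and ρ' code graphs as nodes.
-- Symmetry, transitivity and (strong) extensionality of ≈ follow in this way.  Each set
-- constructor e keeps a copy of its argument a on the nodes i(u), so that e / i(u) ≈ a / u,
-- and the corresponding axiom is read off from the edges of e into its root o.

open import Defs
open import Data.Bool using (Bool; true; false)
open import Data.Nat using (ℕ; zero; suc; _+_)
open import Data.Fin using (Fin; zero; suc; _↑ʳ_; _↑ˡ_)
open import Data.List using (List; []; _∷_; _++_; _ʳ++_; map; replicate; length)
open import Data.List.Membership.Propositional using () renaming (_∈_ to _∈ᴸ_)
open import Data.List.Membership.Propositional.Properties using (∈-map⁺)
open import Data.List.Relation.Unary.Any using () renaming (here to hereᴸ; there to thereᴸ)
open import Data.Product using (_,_)
open import Function using (_∘_)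
open import Relation.Binary.Construct.Closure.Equivalence as Eq using ()
open import Relation.Binary.Construct.Closure.ReflexiveTransitive using (_◅◅_) renaming (ε to εᶜ)
open import Relation.Binary.PropositionalEquality using (_≡_; refl; sym; trans; cong; cong₂; subst; _≗_)

-- Derivations are never weakened, and for an unknown term a lifted renaming of `w1 t` does not
-- evaluate to a weakening. Most lemmas are therefore derived first for bound variables (the names
-- ending in `*`), where all weakenings and instantiations evaluate, and are then specialised to
-- terms by `∀E*`. Membership holds only up to `≈`, whereas the edge rule of `f` tests its formula
-- at one representative `a / y`. Comprehension thus rests on the invariance of translated formulas
-- under `≈`. This is provable because they are built from `≈` and `∈` alone; a formula about `η`
-- could depend on the representative.

-- Renaming, substitution and embedding of terms and formulas

cong₃ : ∀ {A B C D : Set} (h : A → B → C → D) {a a' b b' c c'} →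
  a ≡ a' → b ≡ b' → c ≡ c' → h a b c ≡ h a' b' c'
cong₃ h refl refl refl = refl

infix 4 _≗ˢ_
-- Substitutions are compared pointwise because function extensionality is not assumed; the laws
-- below take such a comparison as hypothesis so that it can be lifted under binders.
_≗ˢ_ : ∀ {b Γ Δ} → Sub b Γ Δ → Sub b Γ Δ → Set
_≗ˢ_ {Γ = Γ} σ τ = ∀ {s} (x : Γ ∋ s) → σ x ≡ τ x

mutual
  renT≡subT : ∀ {b Γ Δ s} {r : Ren Γ Δ} {σ : Sub b Γ Δ} → (λ x → var (r x)) ≗ˢ σ → (t : Tm b Γ s) → renT r t ≡ subT σ t
  renT≡subT e (var x) = e x
  renT≡subT e (root t) = cong root (renT≡subT e t)
  renT≡subT e (iᵐ t) = cong iᵐ (renT≡subT e t)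
  renT≡subT e (i'ᵐ t) = cong i'ᵐ (renT≡subT e t)
  renT≡subT e (jᵐ t) = cong jᵐ (renT≡subT e t)
  renT≡subT e (j'ᵐ t) = cong j'ᵐ (renT≡subT e t)
  renT≡subT e (Sᵐ t) = cong Sᵐ (renT≡subT e t)
  renT≡subT e (Predᵐ t) = cong Predᵐ (renT≡subT e t)
  renT≡subT e (ρ t) = cong ρ (renT≡subT e t)
  renT≡subT e (ρ' t) = cong ρ' (renT≡subT e t)
  renT≡subT e (⋃ t) = cong ⋃ (renT≡subT e t)
  renT≡subT e (𝒫 t) = cong 𝒫 (renT≡subT e t)
  renT≡subT e (Cl t) = cong Cl (renT≡subT e t)
  renT≡subT e (t / u) = cong₂ _/_ (renT≡subT e t) (renT≡subT e u)
  renT≡subT e (pair t u) = cong₂ pair (renT≡subT e t) (renT≡subT e u)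
  renT≡subT e oᵐ = refl
  renT≡subT e 0ᵐ = refl
  renT≡subT e Ω = refl
  renT≡subT e (g P ts) = cong (g P) (renTs≡subTs e ts)
  renT≡subT e (g' P ts) = cong (g' P) (renTs≡subTs e ts)
  renT≡subT e (f P ts t) = cong₂ (f P) (renTs≡subTs e ts) (renT≡subT e t)

  renTs≡subTs : ∀ {b Γ Δ Θ} {r : Ren Γ Δ} {σ : Sub b Γ Δ} → (λ x → var (r x)) ≗ˢ σ → (ts : Tms b Γ Θ) → renTs r ts ≡ subTs σ ts
  renTs≡subTs e ε = refl
  renTs≡subTs e (t ,, ts) = cong₂ _,,_ (renT≡subT e t) (renTs≡subTs e ts)

liftR≗liftS : ∀ {b Γ Δ t} {r : Ren Γ Δ} {σ : Sub b Γ Δ} → (λ x → var (r x)) ≗ˢ σ →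
  (λ x → var (liftR {t = t} r x)) ≗ˢ liftS σ
liftR≗liftS e here = refl
liftR≗liftS e (there x) = cong w1 (e x)

renF≡subF : ∀ {b Γ Δ} {r : Ren Γ Δ} {σ : Sub b Γ Δ} → (λ x → var (r x)) ≗ˢ σ → (A : Fm b Γ) → renF r A ≡ subF σ A
renF≡subF e (η t u v) = cong₃ η (renT≡subT e t) (renT≡subT e u) (renT≡subT e v)
renF≡subF e (rel t u v) = cong₃ rel (renT≡subT e t) (renT≡subT e u) (renT≡subT e v)
renF≡subF e (t ≐ u) = cong₂ _≐_ (renT≡subT e t) (renT≡subT e u)
renF≡subF e (t <ᵐ u) = cong₂ _<ᵐ_ (renT≡subT e t) (renT≡subT e u)
renF≡subF e (t ≈ u) = cong₂ _≈_ (renT≡subT e t) (renT≡subT e u)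
renF≡subF e (t ∈ᵍ u) = cong₂ _∈ᵍ_ (renT≡subT e t) (renT≡subT e u)
renF≡subF e (mem t u) = cong₂ mem (renT≡subT e t) (renT≡subT e u)
renF≡subF e (Iᵐ t) = cong Iᵐ (renT≡subT e t)
renF≡subF e (Jᵐ t) = cong Jᵐ (renT≡subT e t)
renF≡subF e (Nullᵐ t) = cong Nullᵐ (renT≡subT e t)
renF≡subF e (Natᵐ t) = cong Natᵐ (renT≡subT e t)
renF≡subF e ⊤ = refl
renF≡subF e ⊥ = refl
renF≡subF e (A ∧ B) = cong₂ _∧_ (renF≡subF e A) (renF≡subF e B)
renF≡subF e (A ∨ B) = cong₂ _∨_ (renF≡subF e A) (renF≡subF e B)
renF≡subF e (A ⇒ B) = cong₂ _⇒_ (renF≡subF e A) (renF≡subF e B)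
renF≡subF e (∀[ s ] A) = cong ∀[ s ]_ (renF≡subF (liftR≗liftS e) A)
renF≡subF e (∃[ s ] A) = cong ∃[ s ]_ (renF≡subF (liftR≗liftS e) A)

mutual
  subT-id : ∀ {b Γ s} {σ : Sub b Γ Γ} → σ ≗ˢ var → (t : Tm b Γ s) → subT σ t ≡ t
  subT-id e (var x) = e x
  subT-id e (root t) = cong root (subT-id e t)
  subT-id e (iᵐ t) = cong iᵐ (subT-id e t)
  subT-id e (i'ᵐ t) = cong i'ᵐ (subT-id e t)
  subT-id e (jᵐ t) = cong jᵐ (subT-id e t)
  subT-id e (j'ᵐ t) = cong j'ᵐ (subT-id e t)
  subT-id e (Sᵐ t) = cong Sᵐ (subT-id e t)
  subT-id e (Predᵐ t) = cong Predᵐ (subT-id e t)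
  subT-id e (ρ t) = cong ρ (subT-id e t)
  subT-id e (ρ' t) = cong ρ' (subT-id e t)
  subT-id e (⋃ t) = cong ⋃ (subT-id e t)
  subT-id e (𝒫 t) = cong 𝒫 (subT-id e t)
  subT-id e (Cl t) = cong Cl (subT-id e t)
  subT-id e (t / u) = cong₂ _/_ (subT-id e t) (subT-id e u)
  subT-id e (pair t u) = cong₂ pair (subT-id e t) (subT-id e u)
  subT-id e oᵐ = refl
  subT-id e 0ᵐ = refl
  subT-id e Ω = refl
  subT-id e (g P ts) = cong (g P) (subTs-id e ts)
  subT-id e (g' P ts) = cong (g' P) (subTs-id e ts)
  subT-id e (f P ts t) = cong₂ (f P) (subTs-id e ts) (subT-id e t)

  subTs-id : ∀ {b Γ Θ} {σ : Sub b Γ Γ} → σ ≗ˢ var → (ts : Tms b Γ Θ) → subTs σ ts ≡ ts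
  subTs-id e ε = refl
  subTs-id e (t ,, ts) = cong₂ _,,_ (subT-id e t) (subTs-id e ts)

liftS-var : ∀ {b Γ t} {σ : Sub b Γ Γ} → σ ≗ˢ var → liftS {t = t} σ ≗ˢ var
liftS-var e here = refl
liftS-var e (there x) = cong w1 (e x)

subF-id : ∀ {b Γ} {σ : Sub b Γ Γ} → σ ≗ˢ var → (A : Fm b Γ) → subF σ A ≡ A
subF-id e (η t u v) = cong₃ η (subT-id e t) (subT-id e u) (subT-id e v)
subF-id e (rel t u v) = cong₃ rel (subT-id e t) (subT-id e u) (subT-id e v)
subF-id e (t ≐ u) = cong₂ _≐_ (subT-id e t) (subT-id e u)
subF-id e (t <ᵐ u) = cong₂ _<ᵐ_ (subT-id e t) (subT-id e u)
subF-id e (t ≈ u) = cong₂ _≈_ (subT-id e t) (subT-id e u)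
subF-id e (t ∈ᵍ u) = cong₂ _∈ᵍ_ (subT-id e t) (subT-id e u)
subF-id e (mem t u) = cong₂ mem (subT-id e t) (subT-id e u)
subF-id e (Iᵐ t) = cong Iᵐ (subT-id e t)
subF-id e (Jᵐ t) = cong Jᵐ (subT-id e t)
subF-id e (Nullᵐ t) = cong Nullᵐ (subT-id e t)
subF-id e (Natᵐ t) = cong Natᵐ (subT-id e t)
subF-id e ⊤ = refl
subF-id e ⊥ = refl
subF-id e (A ∧ B) = cong₂ _∧_ (subF-id e A) (subF-id e B)
subF-id e (A ∨ B) = cong₂ _∨_ (subF-id e A) (subF-id e B)
subF-id e (A ⇒ B) = cong₂ _⇒_ (subF-id e A) (subF-id e B)
subF-id e (∀[ s ] A) = cong ∀[ s ]_ (subF-id (liftS-var e) A)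
subF-id e (∃[ s ] A) = cong ∃[ s ]_ (subF-id (liftS-var e) A)

mutual
  -- The index formulas of `g`, `g'` and `f` are left alone by substitution, so terms have no
  -- binders. They can be settled before formulas, whose quantifier case needs `liftS-liftS`, itself
  -- a consequence of this lemma.
  subT-subT : ∀ {b Γ Δ Ξ s} {σ : Sub b Δ Ξ} {τ : Sub b Γ Δ} {υ : Sub b Γ Ξ} → (λ x → subT σ (τ x)) ≗ˢ υ →
    (t : Tm b Γ s) → subT σ (subT τ t) ≡ subT υ t
  subT-subT e (var x) = e x
  subT-subT e (root t) = cong root (subT-subT e t)
  subT-subT e (iᵐ t) = cong iᵐ (subT-subT e t)
  subT-subT e (i'ᵐ t) = cong i'ᵐ (subT-subT e t)
  subT-subT e (jᵐ t) = cong jᵐ (subT-subT e t)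
  subT-subT e (j'ᵐ t) = cong j'ᵐ (subT-subT e t)
  subT-subT e (Sᵐ t) = cong Sᵐ (subT-subT e t)
  subT-subT e (Predᵐ t) = cong Predᵐ (subT-subT e t)
  subT-subT e (ρ t) = cong ρ (subT-subT e t)
  subT-subT e (ρ' t) = cong ρ' (subT-subT e t)
  subT-subT e (⋃ t) = cong ⋃ (subT-subT e t)
  subT-subT e (𝒫 t) = cong 𝒫 (subT-subT e t)
  subT-subT e (Cl t) = cong Cl (subT-subT e t)
  subT-subT e (t / u) = cong₂ _/_ (subT-subT e t) (subT-subT e u)
  subT-subT e (pair t u) = cong₂ pair (subT-subT e t) (subT-subT e u)
  subT-subT e oᵐ = refl
  subT-subT e 0ᵐ = refl
  subT-subT e Ω = refl
  subT-subT e (g P ts) = cong (g P) (subTs-subTs e ts)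
  subT-subT e (g' P ts) = cong (g' P) (subTs-subTs e ts)
  subT-subT e (f P ts t) = cong₂ (f P) (subTs-subTs e ts) (subT-subT e t)

  subTs-subTs : ∀ {b Γ Δ Ξ Θ} {σ : Sub b Δ Ξ} {τ : Sub b Γ Δ} {υ : Sub b Γ Ξ} → (λ x → subT σ (τ x)) ≗ˢ υ →
    (ts : Tms b Γ Θ) → subTs σ (subTs τ ts) ≡ subTs υ ts
  subTs-subTs e ε = refl
  subTs-subTs e (t ,, ts) = cong₂ _,,_ (subT-subT e t) (subTs-subTs e ts)

w1≡subT : ∀ {b Γ s t} (u : Tm b Γ s) → w1 {t = t} u ≡ subT (λ x → var (there x)) u
w1≡subT = renT≡subT λ _ → refl

subT-w1 : ∀ {b Γ Δ s t} {σ : Sub b (t ∷ Γ) Δ} (u : Tm b Γ s) → subT σ (w1 u) ≡ subT (λ x → σ (there x)) u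
subT-w1 {σ = σ} u = trans (cong (subT σ) (w1≡subT u)) (subT-subT (λ _ → refl) u)

w1-subT : ∀ {b Γ Δ s t} {σ : Sub b Γ Δ} (u : Tm b Γ s) → w1 {t = t} (subT σ u) ≡ subT (λ x → w1 (σ x)) u
w1-subT {σ = σ} u = trans (w1≡subT (subT σ u)) (subT-subT (λ x → sym (w1≡subT (σ x))) u)

liftS-liftS : ∀ {b Γ Δ Ξ t} {σ : Sub b Δ Ξ} {τ : Sub b Γ Δ} {υ : Sub b Γ Ξ} →
  (λ x → subT σ (τ x)) ≗ˢ υ → (λ x → subT (liftS {t = t} σ) (liftS τ x)) ≗ˢ liftS υ
liftS-liftS e here = refl
liftS-liftS {σ = σ} {τ} e (there x) =
  trans (subT-w1 (τ x)) (trans (sym (w1-subT (τ x))) (cong w1 (e x)))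

subF-subF : ∀ {b Γ Δ Ξ} {σ : Sub b Δ Ξ} {τ : Sub b Γ Δ} {υ : Sub b Γ Ξ} → (λ x → subT σ (τ x)) ≗ˢ υ →
  (A : Fm b Γ) → subF σ (subF τ A) ≡ subF υ A
subF-subF e (η t u v) = cong₃ η (subT-subT e t) (subT-subT e u) (subT-subT e v)
subF-subF e (rel t u v) = cong₃ rel (subT-subT e t) (subT-subT e u) (subT-subT e v)
subF-subF e (t ≐ u) = cong₂ _≐_ (subT-subT e t) (subT-subT e u)
subF-subF e (t <ᵐ u) = cong₂ _<ᵐ_ (subT-subT e t) (subT-subT e u)
subF-subF e (t ≈ u) = cong₂ _≈_ (subT-subT e t) (subT-subT e u)
subF-subF e (t ∈ᵍ u) = cong₂ _∈ᵍ_ (subT-subT e t) (subT-subT e u)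
subF-subF e (mem t u) = cong₂ mem (subT-subT e t) (subT-subT e u)
subF-subF e (Iᵐ t) = cong Iᵐ (subT-subT e t)
subF-subF e (Jᵐ t) = cong Jᵐ (subT-subT e t)
subF-subF e (Nullᵐ t) = cong Nullᵐ (subT-subT e t)
subF-subF e (Natᵐ t) = cong Natᵐ (subT-subT e t)
subF-subF e ⊤ = refl
subF-subF e ⊥ = refl
subF-subF e (A ∧ B) = cong₂ _∧_ (subF-subF e A) (subF-subF e B)
subF-subF e (A ∨ B) = cong₂ _∨_ (subF-subF e A) (subF-subF e B)
subF-subF e (A ⇒ B) = cong₂ _⇒_ (subF-subF e A) (subF-subF e B)
subF-subF e (∀[ s ] A) = cong ∀[ s ]_ (subF-subF (liftS-liftS e) A)
subF-subF e (∃[ s ] A) = cong ∃[ s ]_ (subF-subF (liftS-liftS e) A)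

mutual
  embT-subT : ∀ {Γ Δ s} {σ : Sub false Γ Δ} {τ : Sub true Γ Δ} → (λ x → embT (σ x)) ≗ˢ τ →
    (t : Tm false Γ s) → embT (subT σ t) ≡ subT τ (embT t)
  embT-subT e (var x) = e x
  embT-subT e (root t) = cong root (embT-subT e t)
  embT-subT e (iᵐ t) = cong iᵐ (embT-subT e t)
  embT-subT e (i'ᵐ t) = cong i'ᵐ (embT-subT e t)
  embT-subT e (jᵐ t) = cong jᵐ (embT-subT e t)
  embT-subT e (j'ᵐ t) = cong j'ᵐ (embT-subT e t)
  embT-subT e (Sᵐ t) = cong Sᵐ (embT-subT e t)
  embT-subT e (Predᵐ t) = cong Predᵐ (embT-subT e t)
  embT-subT e (ρ t) = cong ρ (embT-subT e t)
  embT-subT e (ρ' t) = cong ρ' (embT-subT e t)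
  embT-subT e (⋃ t) = cong ⋃ (embT-subT e t)
  embT-subT e (𝒫 t) = cong 𝒫 (embT-subT e t)
  embT-subT e (Cl t) = cong Cl (embT-subT e t)
  embT-subT e (t / u) = cong₂ _/_ (embT-subT e t) (embT-subT e u)
  embT-subT e (pair t u) = cong₂ pair (embT-subT e t) (embT-subT e u)
  embT-subT e oᵐ = refl
  embT-subT e 0ᵐ = refl
  embT-subT e Ω = refl
  embT-subT e (f P ts t) = cong₂ (f P) (embTs-subTs e ts) (embT-subT e t)

  embTs-subTs : ∀ {Γ Δ Θ} {σ : Sub false Γ Δ} {τ : Sub true Γ Δ} → (λ x → embT (σ x)) ≗ˢ τ →
    (ts : Tms false Γ Θ) → embTs (subTs σ ts) ≡ subTs τ (embTs ts)
  embTs-subTs e ε = refl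
  embTs-subTs e (t ,, ts) = cong₂ _,,_ (embT-subT e t) (embTs-subTs e ts)

embT-w1 : ∀ {Γ s t} (u : Tm false Γ s) → embT (w1 {t = t} u) ≡ w1 (embT u)
embT-w1 u = trans (cong embT (w1≡subT u)) (trans (embT-subT (λ _ → refl) u) (sym (w1≡subT (embT u))))

embT-liftS : ∀ {Γ Δ t} {σ : Sub false Γ Δ} {τ : Sub true Γ Δ} → (λ x → embT (σ x)) ≗ˢ τ →
  (λ x → embT (liftS {t = t} σ x)) ≗ˢ liftS τ
embT-liftS e here = refl
embT-liftS {σ = σ} e (there x) = trans (embT-w1 (σ x)) (cong w1 (e x))

-- Needed because decoding of parameters is substituted into an index formula before `inst` embeds
-- it.
embF-subF : ∀ {Γ Δ} {σ : Sub false Γ Δ} {τ : Sub true Γ Δ} → (λ x → embT (σ x)) ≗ˢ τ →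
  (A : Fm false Γ) → embF (subF σ A) ≡ subF τ (embF A)
embF-subF e (η t u v) = cong₃ η (embT-subT e t) (embT-subT e u) (embT-subT e v)
embF-subF e (rel t u v) = cong₃ rel (embT-subT e t) (embT-subT e u) (embT-subT e v)
embF-subF e (t ≐ u) = cong₂ _≐_ (embT-subT e t) (embT-subT e u)
embF-subF e (t <ᵐ u) = cong₂ _<ᵐ_ (embT-subT e t) (embT-subT e u)
embF-subF e (t ≈ u) = cong₂ _≈_ (embT-subT e t) (embT-subT e u)
embF-subF e (t ∈ᵍ u) = cong₂ _∈ᵍ_ (embT-subT e t) (embT-subT e u)
embF-subF e (mem t u) = cong₂ mem (embT-subT e t) (embT-subT e u)
embF-subF e (Iᵐ t) = cong Iᵐ (embT-subT e t)
embF-subF e (Jᵐ t) = cong Jᵐ (embT-subT e t)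
embF-subF e (Nullᵐ t) = cong Nullᵐ (embT-subT e t)
embF-subF e (Natᵐ t) = cong Natᵐ (embT-subT e t)
embF-subF e ⊤ = refl
embF-subF e ⊥ = refl
embF-subF e (A ∧ B) = cong₂ _∧_ (embF-subF e A) (embF-subF e B)
embF-subF e (A ∨ B) = cong₂ _∨_ (embF-subF e A) (embF-subF e B)
embF-subF e (A ⇒ B) = cong₂ _⇒_ (embF-subF e A) (embF-subF e B)
embF-subF e (∀[ s ] A) = cong ∀[ s ]_ (embF-subF (embT-liftS e) A)
embF-subF e (∃[ s ] A) = cong ∃[ s ]_ (embF-subF (embT-liftS e) A)

subT-▸-w1 : ∀ {b Γ s t} (u : Tm b Γ s) {v : Tm b Γ t} → subT (v ▸_) (w1 u) ≡ u
subT-▸-w1 u = trans (subT-w1 u) (subT-id (λ _ → refl) u)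

wTs : ∀ {b Γ Θ t} → Tms b Γ Θ → Tms b (t ∷ Γ) Θ
wTs = renTs there

subTs-▸-wTs : ∀ {b Γ Θ t} (ts : Tms b Γ Θ) {v : Tm b Γ t} → subTs (v ▸_) (wTs ts) ≡ ts
subTs-▸-wTs ε = refl
subTs-▸-wTs (u ,, ts) = cong₂ _,,_ (subT-▸-w1 u) (subTs-▸-wTs ts)

subT-lookupTms : ∀ {b Γ Δ Θ s} (σ : Sub b Γ Δ) (ts : Tms b Γ Θ) (x : Θ ∋ s) →
  subT σ (lookupTms ts x) ≡ lookupTms (subTs σ ts) x
subT-lookupTms σ (t ,, ts) here = refl
subT-lookupTms σ (t ,, ts) (there x) = subT-lookupTms σ ts x

subF-lookupTms : ∀ {b Γ Δ Θ} (σ : Sub b Γ Δ) (ts : Tms b Γ Θ) (A : Fm b Θ) →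
  subF σ (subF (lookupTms ts) A) ≡ subF (lookupTms (subTs σ ts)) A
subF-lookupTms σ ts A = subF-subF (subT-lookupTms σ ts) A

infixr 5 _∷ₛ_
_∷ₛ_ : ∀ {b Γ Δ s} → Tm b Δ s → Sub b Γ Δ → Sub b (s ∷ Γ) Δ
(t ∷ₛ σ) here = t
(t ∷ₛ σ) (there x) = σ x

subF-liftS-[] : ∀ {b Γ Δ s} {σ : Sub b Γ Δ} {υ : Sub b (s ∷ Γ) Δ} (t : Tm b Δ s) (A : Fm b (s ∷ Γ)) →
  (t ∷ₛ σ) ≗ˢ υ → subF (liftS σ) A [ t ] ≡ subF υ A
subF-liftS-[] {σ = σ} t A e = subF-subF (λ { here → e here ; (there x) → trans (subT-▸-w1 (σ x)) (e (there x)) }) A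

-- Conversion

≡⇒≡ᵐ : ∀ {Γ} {A B : Fm true Γ} → A ≡ B → A ≡ᵐ B
≡⇒≡ᵐ refl = εᶜ

≡ᵐ-sym : ∀ {Γ} {A B : Fm true Γ} → A ≡ᵐ B → B ≡ᵐ A
≡ᵐ-sym = Eq.symmetric _

cong-∧ : ∀ {Γ} {A A' B B' : Fm true Γ} → A ≡ᵐ A' → B ≡ᵐ B' → (A ∧ B) ≡ᵐ (A' ∧ B')
cong-∧ p q = Eq.gmap (_∧ _) ∧₁ p ◅◅ Eq.gmap (_ ∧_) ∧₂ q

cong-⇒ : ∀ {Γ} {A A' B B' : Fm true Γ} → A ≡ᵐ A' → B ≡ᵐ B' → (A ⇒ B) ≡ᵐ (A' ⇒ B')
cong-⇒ p q = Eq.gmap (_⇒ _) ⇒₁ p ◅◅ Eq.gmap (_ ⇒_) ⇒₂ q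

cong-∀ : ∀ {Γ s} {A A' : Fm true (s ∷ Γ)} → A ≡ᵐ A' → (∀[ s ] A) ≡ᵐ (∀[ s ] A')
cong-∀ = Eq.gmap ∀[ _ ]_ ∀c

cong-∃ : ∀ {Γ s} {A A' : Fm true (s ∷ Γ)} → A ≡ᵐ A' → (∃[ s ] A) ≡ᵐ (∃[ s ] A')
cong-∃ = Eq.gmap ∃[ _ ]_ ∃c

≡ᵐ-atom : ∀ {Γ} {A B : Fm true Γ} → A ↦ᵃ B → A ≡ᵐ B
≡ᵐ-atom r = Eq.return (atom r)

-- The other terms of the formula are kept in `ts`, so that `K` can be written with concrete
-- variables and both sides evaluate to the intended formulas.
≡ᵐ-term : ∀ {Γ Θ s} (K : Fm true (s ∷ Θ)) (ts : Tms true Γ Θ) {l r : Tm true Γ s} → l ↦ᵗ r →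
  subF (lookupTms (l ,, ts)) K ≡ᵐ subF (lookupTms (r ,, ts)) K
≡ᵐ-term K ts {l} {r} l↦r =
  ≡⇒≡ᵐ (sym (subF-liftS-[] l K λ { here → refl ; (there _) → refl }))
  ◅◅ Eq.return (term (subF (liftS (lookupTms ts)) K) l↦r)
  ◅◅ ≡⇒≡ᵐ (subF-liftS-[] r K λ { here → refl ; (there _) → refl })

-- Comprehension with parameters of sorts N and G

infixr 5 _ʳ,,_
-- A zipper: the entries already passed are stored in reverse, so `(t ,, xs) ʳ,, ts` and
-- `xs ʳ,, (t ,, ts)` are equal by definition and an induction can move its focus without transport.
_ʳ,,_ : ∀ {b Γ Ξ Θ} → Tms b Γ Ξ → Tms b Γ Θ → Tms b Γ (Ξ ʳ++ Θ)
ε ʳ,, ts = ts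
(x ,, xs) ʳ,, ts = xs ʳ,, (x ,, ts)

subTs-ʳ,, : ∀ {b Γ Δ Ξ Θ} (σ : Sub b Γ Δ) (xs : Tms b Γ Ξ) (ts : Tms b Γ Θ) →
  subTs σ (xs ʳ,, ts) ≡ subTs σ xs ʳ,, subTs σ ts
subTs-ʳ,, σ ε ts = refl
subTs-ʳ,, σ (x ,, xs) ts = subTs-ʳ,, σ xs (x ,, ts)

liftSʳ : ∀ {b} Ξ {Θ Δ} → Sub b Θ Δ → Sub b (Ξ ʳ++ Θ) (Ξ ʳ++ Δ)
liftSʳ [] σ = σ
liftSʳ (s ∷ Ξ) σ = liftSʳ Ξ (liftS σ)

-- The contexts whose variables can be coded by nodes; sorts `C` and `R` have no such code. For
-- concrete contexts the witness is found by instance search.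
data NG : Ctx → Set where
  instance
    none  : NG []
    node  : ∀ {Θ} → ⦃ NG Θ ⦄ → NG (N ∷ Θ)
    graph : ∀ {Θ} → ⦃ NG Θ ⦄ → NG (G ∷ Θ)

-- The symbols g and g' only take node parameters: a graph parameter a is passed as
-- the node ρ(a) and read back as ρ'(ρ(a)).
encode : ∀ {Γ Θ} → NG Θ → Tms true Γ Θ → Tms true Γ (replicate (length Θ) N)
encode none ε = ε
encode (node ⦃ w ⦄) (t ,, ts) = t ,, encode w ts
encode (graph ⦃ w ⦄) (t ,, ts) = ρ t ,, encode w ts

decode : ∀ {Θ} → NG Θ → Sub false Θ (replicate (length Θ) N)
decode node here = v0
decode (node ⦃ w ⦄) (there x) = w1 (decode w x)
decode graph here = ρ' v0
decode (graph ⦃ w ⦄) (there x) = w1 (decode w x)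

ρ'ρs : ∀ {Γ Θ} → NG Θ → Tms true Γ Θ → Tms true Γ Θ
ρ'ρs none ε = ε
ρ'ρs (node ⦃ w ⦄) (t ,, ts) = t ,, ρ'ρs w ts
ρ'ρs (graph ⦃ w ⦄) (t ,, ts) = ρ' (ρ t) ,, ρ'ρs w ts

embT-w1-lookupTms : ∀ {Γ Δ s t} (u : Tm false Δ s) {v : Tm true Γ t} {vs : Tms true Γ Δ} →
  subT (lookupTms (v ,, vs)) (embT (w1 u)) ≡ subT (lookupTms vs) (embT u)
embT-w1-lookupTms u = trans (cong (subT _) (embT-w1 u)) (subT-w1 (embT u))

decode-encode : ∀ {Γ Θ} (w : NG Θ) (ts : Tms true Γ Θ) {s} (x : Θ ∋ s) →
  subT (lookupTms (encode w ts)) (embT (decode w x)) ≡ lookupTms (ρ'ρs w ts) x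
decode-encode node (t ,, ts) here = refl
decode-encode (node ⦃ w ⦄) (t ,, ts) (there x) =
  trans (embT-w1-lookupTms (decode w x)) (decode-encode w ts x)
decode-encode graph (t ,, ts) here = refl
decode-encode (graph ⦃ w ⦄) (t ,, ts) (there x) =
  trans (embT-w1-lookupTms (decode w x)) (decode-encode w ts x)

lookupTms-liftSʳ : ∀ {Γ Ξ Θ Δ} (xs : Tms true Γ Ξ) {σ : Sub false Θ Δ} {us : Tms true Γ Δ} {vs : Tms true Γ Θ} →
  (∀ {s} (x : Θ ∋ s) → subT (lookupTms us) (embT (σ x)) ≡ lookupTms vs x) →
  ∀ {s} (x : (Ξ ʳ++ Θ) ∋ s) →
  subT (lookupTms (xs ʳ,, us)) (embT (liftSʳ Ξ σ x)) ≡ lookupTms (xs ʳ,, vs) x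
lookupTms-liftSʳ ε e = e
lookupTms-liftSʳ (t ,, xs) {σ} e = lookupTms-liftSʳ xs
  λ { here → refl ; (there x) → trans (embT-w1-lookupTms (σ x)) (e x) }

-- A rewrite step replaces one redex, so the coded graphs are restored one after another: `K`
-- abstracts the parameter in focus, which then joins `xs`.
ρ'ρs-≡ᵐ : ∀ {Γ Ξ Θ} (xs : Tms true Γ Ξ) (w : NG Θ) (ts : Tms true Γ Θ) (A : Fm true (Ξ ʳ++ Θ)) →
  subF (lookupTms (xs ʳ,, ρ'ρs w ts)) A ≡ᵐ subF (lookupTms (xs ʳ,, ts)) A
ρ'ρs-≡ᵐ xs none ε A = εᶜ
ρ'ρs-≡ᵐ xs (node ⦃ w ⦄) (t ,, ts) A = ρ'ρs-≡ᵐ (t ,, xs) w ts A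
ρ'ρs-≡ᵐ xs (graph ⦃ w ⦄) (t ,, ts) A =
  replace ◅◅ ρ'ρs-≡ᵐ (t ,, xs) w ts A
  where
  us = ρ'ρs w ts
  K = subF (lookupTms (wTs xs ʳ,, (v0 ,, wTs us))) A
  plug : ∀ u → K [ u ] ≡ subF (lookupTms (xs ʳ,, (u ,, us))) A
  plug u = trans (subF-lookupTms (u ▸_) (wTs xs ʳ,, (v0 ,, wTs us)) A)
    (cong (λ ts → subF (lookupTms ts) A)
      (trans (subTs-ʳ,, (u ▸_) (wTs xs) (v0 ,, wTs us))
        (cong₂ (λ xs us → xs ʳ,, (u ,, us)) (subTs-▸-wTs xs) (subTs-▸-wTs us))))
  replace : subF (lookupTms (xs ʳ,, (ρ' (ρ t) ,, us))) A ≡ᵐ subF (lookupTms (xs ʳ,, (t ,, us))) A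
  replace = ≡⇒≡ᵐ (sym (plug _)) ◅◅ Eq.return (term K t-ρ'ρ) ◅◅ ≡⇒≡ᵐ (plug t)

inst-decode-encode : ∀ {Γ Ξ Θ} (xs : Tms true Γ Ξ) (w : NG Θ) (ts : Tms true Γ Θ) (φ : Fm false (Ξ ʳ++ Θ)) →
  inst (subF (liftSʳ Ξ (decode w)) φ) (xs ʳ,, encode w ts) ≡ᵐ inst φ (xs ʳ,, ts)
inst-decode-encode {Ξ = Ξ} xs w ts φ =
  ≡⇒≡ᵐ (trans (cong (subF _) (embF-subF (λ _ → refl) φ))
              (subF-subF (lookupTms-liftSʳ xs (decode-encode w ts)) (embF φ)))
  ◅◅ ρ'ρs-≡ᵐ xs w ts (embF φ)

class : ∀ {Γ Θ} → Fm false (N ∷ Θ) → ⦃ NG Θ ⦄ → Tms true Γ Θ → Tm true Γ C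
class φ ⦃ w ⦄ ts = g (subF (liftS (decode w)) φ) (encode w ts)

relation : ∀ {Γ Θ} → Fm false (N ∷ N ∷ Θ) → ⦃ NG Θ ⦄ → Tms true Γ Θ → Tm true Γ R
relation φ ⦃ w ⦄ ts = g' (subF (liftS (liftS (decode w))) φ) (encode w ts)

mem-class : ∀ {Γ Θ} (φ : Fm false (N ∷ Θ)) ⦃ w : NG Θ ⦄ (ts : Tms true Γ Θ) {x} →
  mem x (class φ ts) ≡ᵐ inst φ (x ,, ts)
mem-class φ ⦃ w ⦄ ts {x} = ≡ᵐ-atom a-g ◅◅ inst-decode-encode (x ,, ε) w ts φ

rel-relation : ∀ {Γ Θ} (φ : Fm false (N ∷ N ∷ Θ)) ⦃ w : NG Θ ⦄ (ts : Tms true Γ Θ) {x y} →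
  rel x y (relation φ ts) ≡ᵐ inst φ (x ,, y ,, ts)
rel-relation φ ⦃ w ⦄ ts {x} {y} = ≡ᵐ-atom a-g' ◅◅ inst-decode-encode (y ,, x ,, ε) w ts φ

relation-wTs : ∀ {Γ Θ t} (φ : Fm false (N ∷ N ∷ Θ)) ⦃ w : NG Θ ⦄ (ts : Tms true Γ Θ) →
  w1 {t = t} (relation φ ts) ≡ relation φ (wTs ts)
relation-wTs φ ⦃ w ⦄ ts = cong (g' _) (encode-wTs w ts)
  where
  encode-wTs : ∀ {Γ Θ t} (w : NG Θ) (ts : Tms true Γ Θ) → wTs {t = t} (encode w ts) ≡ encode w (wTs ts)
  encode-wTs none ε = refl
  encode-wTs (node ⦃ w ⦄) (t ,, ts) = cong (_ ,,_) (encode-wTs w ts)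
  encode-wTs (graph ⦃ w ⦄) (t ,, ts) = cong (_ ,,_) (encode-wTs w ts)

-- Derived rules

⟪_⟫ : ∀ {Γ Δ Θ} → Tms true Δ Θ → Sub true Γ Δ → Sub true (Θ ++ Γ) Δ
⟪ ε ⟫ σ x = σ x
⟪ t ,, ts ⟫ σ here = t
⟪ t ,, ts ⟫ σ (there x) = ⟪ ts ⟫ σ x

∀* : ∀ Θ {Γ} → Fm true (Θ ++ Γ) → Fm true Γ
∀* [] A = A
∀* (s ∷ Θ) A = ∀* Θ (∀[ s ] A)

-- The conclusion uses one simultaneous substitution because it evaluates on a concrete `A`;
-- iterated `_[_]` would leave stuck terms of the form `subT (t ▸_) (w1 u)`.
∀E* : ∀ {Γ Θ Hs} {A : Fm true (Θ ++ Γ)} → Hs ⊢ᵐ ∀* Θ A → (ts : Tms true Γ Θ) → Hs ⊢ᵐ subF (⟪ ts ⟫ var) A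
∀E* {A = A} h ε = subst (_ ⊢ᵐ_) (sym (subF-id (λ _ → refl) A)) h
∀E* {A = A} h (t ,, ts) = subst (_ ⊢ᵐ_)
  (subF-liftS-[] t A λ { here → refl ; (there _) → refl }) (∀E (∀E* h ts) t)

unfold : ∀ {Γ Hs} {A B : Fm true Γ} → A ↦ᵃ B → Hs ⊢ᵐ A → Hs ⊢ᵐ B
unfold r h = conv h (≡ᵐ-atom r)

fold : ∀ {Γ Hs} {A B : Fm true Γ} → A ↦ᵃ B → Hs ⊢ᵐ B → Hs ⊢ᵐ A
fold r h = conv h (≡ᵐ-sym (≡ᵐ-atom r))

cut : ∀ {Γ Hs} {A B : Fm true Γ} → Hs ⊢ᵐ A → (A ∷ Hs) ⊢ᵐ B → Hs ⊢ᵐ B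
cut h k = ⇒E (⇒I k) h

h0 : ∀ {Γ Hs} {A : Fm true Γ} → (A ∷ Hs) ⊢ᵐ A
h0 = hyp (hereᴸ refl)
h1 : ∀ {Γ Hs} {A B : Fm true Γ} → (B ∷ A ∷ Hs) ⊢ᵐ A
h1 = hyp (thereᴸ (hereᴸ refl))
h2 : ∀ {Γ Hs} {A B₀ B₁ : Fm true Γ} → (B₀ ∷ B₁ ∷ A ∷ Hs) ⊢ᵐ A
h2 = hyp (thereᴸ (thereᴸ (hereᴸ refl)))
h3 : ∀ {Γ Hs} {A B₀ B₁ B₂ : Fm true Γ} → (B₀ ∷ B₁ ∷ B₂ ∷ A ∷ Hs) ⊢ᵐ A
h3 = hyp (thereᴸ (thereᴸ (thereᴸ (hereᴸ refl))))
h4 : ∀ {Γ Hs} {A B₀ B₁ B₂ B₃ : Fm true Γ} → (B₀ ∷ B₁ ∷ B₂ ∷ B₃ ∷ A ∷ Hs) ⊢ᵐ A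
h4 = hyp (thereᴸ (thereᴸ (thereᴸ (thereᴸ (hereᴸ refl)))))
h5 : ∀ {Γ Hs} {A B₀ B₁ B₂ B₃ B₄ : Fm true Γ} → (B₀ ∷ B₁ ∷ B₂ ∷ B₃ ∷ B₄ ∷ A ∷ Hs) ⊢ᵐ A
h5 = hyp (thereᴸ (thereᴸ (thereᴸ (thereᴸ (thereᴸ (hereᴸ refl))))))
h7 : ∀ {Γ Hs} {A B₀ B₁ B₂ B₃ B₄ B₅ B₆ : Fm true Γ} → (B₀ ∷ B₁ ∷ B₂ ∷ B₃ ∷ B₄ ∷ B₅ ∷ B₆ ∷ A ∷ Hs) ⊢ᵐ A
h7 = hyp (thereᴸ (thereᴸ (thereᴸ (thereᴸ (thereᴸ (thereᴸ (thereᴸ (hereᴸ refl))))))))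

infix 15 _⇔_
_⇔_ : ∀ {Γ} → Fm true Γ → Fm true Γ → Fm true Γ
A ⇔ B = (A ⇒ B) ∧ (B ⇒ A)

-- Leibniz equality of nodes

≐-refl : ∀ {Γ Hs} {x : Tm true Γ N} → Hs ⊢ᵐ x ≐ x
≐-refl = fold a-eq (∀I (⇒I h0))

-- Equality rewrites to a quantification over classes, so a property can be transported only through
-- the class symbol that comprehension attaches to it.
≐-subst : ∀ {Γ Hs Θ} (φ : Fm false (N ∷ Θ)) ⦃ w : NG Θ ⦄ (ts : Tms true Γ Θ) {x y} →
  Hs ⊢ᵐ x ≐ y → Hs ⊢ᵐ inst φ (x ,, ts) → Hs ⊢ᵐ inst φ (y ,, ts)
≐-subst {Hs = Hs} φ ts {x} {y} e h =
  conv (⇒E (subst (Hs ⊢ᵐ_)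
              (cong₂ (λ x y → mem x c ⇒ mem y c) (subT-▸-w1 x) (subT-▸-w1 y))
              (∀E (unfold a-eq e) c))
           (conv h (≡ᵐ-sym (mem-class φ ts))))
       (mem-class φ ts)
  where c = class φ ts

≐-sym : ∀ {Γ Hs} {x y : Tm true Γ N} → Hs ⊢ᵐ x ≐ y → Hs ⊢ᵐ y ≐ x
≐-sym {x = x} e = ≐-subst (v0 ≐ v1) (x ,, ε) e ≐-refl

-- The transported property of a node is that `x` equals its image under `i'ᵐ`: at `iᵐ x` it
-- rewrites to reflexivity, at `iᵐ y` to the claim.
iᵐ-injective : ∀ {Γ Hs} {x y : Tm true Γ N} → Hs ⊢ᵐ iᵐ x ≐ iᵐ y → Hs ⊢ᵐ x ≐ y
iᵐ-injective {x = x} {y} e =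
  conv (≐-subst (v1 ≐ i'ᵐ v0) (x ,, ε) e (conv ≐-refl (≡ᵐ-sym (≡ᵐ-term (v1 ≐ v0) (x ,, ε) t-i'i))))
       (≡ᵐ-term (v1 ≐ v0) (x ,, ε) t-i'i)

jᵐ-injective : ∀ {Γ Hs} {x y : Tm true Γ N} → Hs ⊢ᵐ jᵐ x ≐ jᵐ y → Hs ⊢ᵐ x ≐ y
jᵐ-injective {x = x} {y} e =
  conv (≐-subst (v1 ≐ j'ᵐ v0) (x ,, ε) e (conv ≐-refl (≡ᵐ-sym (≡ᵐ-term (v1 ≐ v0) (x ,, ε) t-j'j))))
       (≡ᵐ-term (v1 ≐ v0) (x ,, ε) t-j'j)

i≐o-absurd : ∀ {Γ Hs} {x : Tm true Γ N} {D} → Hs ⊢ᵐ iᵐ x ≐ oᵐ → Hs ⊢ᵐ D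
i≐o-absurd e = ⊥E (unfold a-Io (≐-subst (Iᵐ v0) ε e (fold a-Ii ⊤I)))

j≐o-absurd : ∀ {Γ Hs} {x : Tm true Γ N} {D} → Hs ⊢ᵐ jᵐ x ≐ oᵐ → Hs ⊢ᵐ D
j≐o-absurd e = ⊥E (unfold a-Jo (≐-subst (Jᵐ v0) ε e (fold a-Jj ⊤I)))

i≐j-absurd : ∀ {Γ Hs} {x y : Tm true Γ N} {D} → Hs ⊢ᵐ iᵐ x ≐ jᵐ y → Hs ⊢ᵐ D
i≐j-absurd e = ⊥E (unfold a-Ij (≐-subst (Iᵐ v0) ε e (fold a-Ii ⊤I)))

-- Bisimilarity of nodes

Bisimulation : ∀ {Γ} → Tm true Γ G → Tm true Γ N → Tm true Γ G → Tm true Γ N → Tm true Γ R → Fm true Γ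
Bisimulation a x b y r = rel x y r
  ∧ (∀[ N ] ∀[ N ] ∀[ N ] ((η (w3 a) v1 v2 ∧ rel v2 v0 (w3 r))
                         ⇒ ∃[ N ] (η (w4 b) v0 v1 ∧ rel v2 v0 (w4 r))))
  ∧ (∀[ N ] ∀[ N ] ∀[ N ] ((η (w3 b) v1 v2 ∧ rel v0 v2 (w3 r))
                         ⇒ ∃[ N ] (η (w4 a) v0 v1 ∧ rel v0 v2 (w4 r))))

-- The right-hand side of the rule for `≈` with arbitrary nodes in place of the two roots. Since
-- `a / x` has the edges of `a` and the root `x`, the formula `a / x ≈ b / y` is congruent to it.
Bisimilar : ∀ {Γ} → Tm true Γ G → Tm true Γ N → Tm true Γ G → Tm true Γ N → Fm true Γ
Bisimilar a x b y = ∃[ R ] Bisimulation (w1 a) (w1 x) (w1 b) (w1 y) v0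

≈-≡ᵐ : ∀ {Γ} {a b : Tm true Γ G} → (a ≈ b) ≡ᵐ Bisimilar a (root a) b (root b)
≈-≡ᵐ = ≡ᵐ-atom a-≈

Bisimilar-/ˡ : ∀ {Γ} {a b : Tm true Γ G} {x y z} → Bisimilar (a / z) x b y ≡ᵐ Bisimilar a x b y
Bisimilar-/ˡ = cong-∃ (cong-∧ εᶜ (cong-∧
  (cong-∀ (cong-∀ (cong-∀ (cong-⇒ (cong-∧ (≡ᵐ-atom a-η/) εᶜ) εᶜ))))
  (cong-∀ (cong-∀ (cong-∀ (cong-⇒ εᶜ (cong-∃ (cong-∧ (≡ᵐ-atom a-η/) εᶜ))))))))

Bisimilar-/ʳ : ∀ {Γ} {a b : Tm true Γ G} {x y z} → Bisimilar a x (b / z) y ≡ᵐ Bisimilar a x b y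
Bisimilar-/ʳ = cong-∃ (cong-∧ εᶜ (cong-∧
  (cong-∀ (cong-∀ (cong-∀ (cong-⇒ εᶜ (cong-∃ (cong-∧ (≡ᵐ-atom a-η/) εᶜ))))))
  (cong-∀ (cong-∀ (cong-∀ (cong-⇒ (cong-∧ (≡ᵐ-atom a-η/) εᶜ) εᶜ))))))

≈/ʳ-≡ᵐ : ∀ {Γ} {a b : Tm true Γ G} {y} → (a ≈ b / y) ≡ᵐ Bisimilar a (root a) b y
≈/ʳ-≡ᵐ {a = a} {b} {y} = ≈-≡ᵐ ◅◅ Bisimilar-/ʳ
  ◅◅ ≡ᵐ-term (Bisimilar v1 v2 v3 v0) (a ,, root a ,, b ,, ε) t-root/

≈/-≡ᵐ : ∀ {Γ} {a b : Tm true Γ G} {x y} → (a / x ≈ b / y) ≡ᵐ Bisimilar a x b y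
≈/-≡ᵐ {a = a} {b} {x} {y} = ≈/ʳ-≡ᵐ ◅◅ Bisimilar-/ˡ
  ◅◅ ≡ᵐ-term (Bisimilar v1 v0 v2 v3) (a ,, b ,, y ,, ε) t-root/

-- Brings a hypothesis about whole graphs into the form that `≈-forth` and `≈-back` accept.
≈-root-≡ᵐ : ∀ {Γ} {a b : Tm true Γ G} → (a ≈ b) ≡ᵐ (a / root a ≈ b / root b)
≈-root-≡ᵐ = ≈-≡ᵐ ◅◅ ≡ᵐ-sym ≈/-≡ᵐ

Bisimulation-[] : ∀ {Γ} {a b : Tm true Γ G} {x y} (r : Tm true Γ R) →
  Bisimulation (w1 a) (w1 x) (w1 b) (w1 y) v0 [ r ] ≡ Bisimulation a x b y r
Bisimulation-[] {a = a} {b} {x} {y} r = trans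
  (subF-lookupTms (r ▸_) (wTs (a ,, x ,, b ,, y ,, ε) ʳ,, v0 ,, ε) K)
  (cong (λ ts → subF (lookupTms (ts ʳ,, r ,, ε)) K) (subTs-▸-wTs (a ,, x ,, b ,, y ,, ε)))
  where
  K : Fm true (N ∷ G ∷ N ∷ G ∷ R ∷ [])
  K = Bisimulation v3 v2 v1 v0 (var (there (there (there (there here)))))

wHs : ∀ {Γ s} → List (Fm true Γ) → List (Fm true (s ∷ Γ))
wHs = map (renF there)

-- The premises give a bisimulation because the relation defined by φ exists by comprehension.
coinduction : ∀ {Γ Θ Hs} (φ : Fm false (N ∷ N ∷ Θ)) ⦃ w : NG Θ ⦄ (ts : Tms true Γ Θ)
  {a b : Tm true Γ G} {x y : Tm true Γ N} →
  Hs ⊢ᵐ inst φ (x ,, y ,, ts) →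
  (η (w3 a) v1 v2 ∧ inst φ (v2 ,, v0 ,, wTs (wTs (wTs ts))) ∷ wHs (wHs (wHs Hs)))
    ⊢ᵐ ∃[ N ] (η (w4 b) v0 v1 ∧ inst φ (v2 ,, v0 ,, wTs (wTs (wTs (wTs ts))))) →
  (η (w3 b) v1 v2 ∧ inst φ (v0 ,, v2 ,, wTs (wTs (wTs ts))) ∷ wHs (wHs (wHs Hs)))
    ⊢ᵐ ∃[ N ] (η (w4 a) v0 v1 ∧ inst φ (v0 ,, v2 ,, wTs (wTs (wTs (wTs ts))))) →
  Hs ⊢ᵐ Bisimilar a x b y
coinduction {Hs = Hs} φ ts {a} {b} {x} {y} start forth back =
  ∃I r (subst (Hs ⊢ᵐ_) (sym (Bisimulation-[] {a = a} {b} {x} {y} r))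
    (conv (∧I start (∧I (∀I (∀I (∀I (⇒I forth)))) (∀I (∀I (∀I (⇒I back))))))
      (≡ᵐ-sym (cong-∧ (rel-relation φ ts) (cong-∧
        (cong-∀ (cong-∀ (cong-∀ (cong-⇒ (cong-∧ εᶜ rel₃) (cong-∃ (cong-∧ εᶜ rel₄))))))
        (cong-∀ (cong-∀ (cong-∀ (cong-⇒ (cong-∧ εᶜ rel₃) (cong-∃ (cong-∧ εᶜ rel₄)))))))))))
  where
  r = relation φ ts
  r₃ : ∀ {t u v} → w3 {t₁ = t} {u} {v} r ≡ relation φ (wTs (wTs (wTs ts)))
  r₃ = trans (cong w2 (relation-wTs φ ts)) (trans (cong w1 (relation-wTs φ _)) (relation-wTs φ _))
  rel₃ : ∀ {t u v} {x y : Tm true (t ∷ u ∷ v ∷ _) N} →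
    rel x y (w3 r) ≡ᵐ inst φ (x ,, y ,, wTs (wTs (wTs ts)))
  rel₃ {x = x} {y} = ≡⇒≡ᵐ (cong (rel x y) r₃) ◅◅ rel-relation φ _
  rel₄ : ∀ {t u v w} {x y : Tm true (t ∷ u ∷ v ∷ w ∷ _) N} →
    rel x y (w4 r) ≡ᵐ inst φ (x ,, y ,, wTs (wTs (wTs (wTs ts))))
  rel₄ {x = x} {y} = ≡⇒≡ᵐ (cong (rel x y) (trans (cong w1 r₃) (relation-wTs φ _))) ◅◅ rel-relation φ _

-- The relation witnessing the hypothesis serves again for the pair of children: only the first
-- clause of `Bisimulation` mentions the starting nodes.
≈-forth* : ∀ {Γ Hs} → Hs ⊢ᵐ ∀* (N ∷ N ∷ N ∷ G ∷ G ∷ []) {Γ}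
  (v4 / v2 ≈ v3 / v1 ⇒ η v4 v0 v2 ⇒ ∃[ N ] (η (w1 v3) v0 (w1 v1) ∧ w1 v4 / w1 v0 ≈ w1 v3 / v0))
≈-forth* = ∀I (∀I (∀I (∀I (∀I (⇒I (⇒I (∃E (conv h1 ≈/-≡ᵐ)
  (∃E (⇒E (∀E (∀E (∀E (∧E₁ (∧E₂ h0)) v3) v1) v2) (∧I h1 (∧E₁ h0)))
    (∃I v0 (∧I (∧E₁ h0) (conv (∃I v1 (∧I (∧E₂ h0) (∧E₂ h1))) (≡ᵐ-sym ≈/-≡ᵐ)))))))))))) 

≈-back* : ∀ {Γ Hs} → Hs ⊢ᵐ ∀* (N ∷ N ∷ N ∷ G ∷ G ∷ []) {Γ}
  (v4 / v2 ≈ v3 / v1 ⇒ η v3 v0 v1 ⇒ ∃[ N ] (η (w1 v4) v0 (w1 v2) ∧ w1 v4 / v0 ≈ w1 v3 / w1 v0))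
≈-back* = ∀I (∀I (∀I (∀I (∀I (⇒I (⇒I (∃E (conv h1 ≈/-≡ᵐ)
  (∃E (⇒E (∀E (∀E (∀E (∧E₂ (∧E₂ h0)) v2) v1) v3) (∧I h1 (∧E₁ h0)))
    (∃I v0 (∧I (∧E₁ h0) (conv (∃I v1 (∧I (∧E₂ h0) (∧E₂ h1))) (≡ᵐ-sym ≈/-≡ᵐ))))))))))))

v5 : ∀ {b Γ s t₀ t₁ t₂ t₃ t₄} → Tm b (t₀ ∷ t₁ ∷ t₂ ∷ t₃ ∷ t₄ ∷ s ∷ Γ) s
v5 = w1 v4

module _ {Γ} {Hs : List (Fm true Γ)} where

  ≈-forth : ∀ {a b x y x'} → Hs ⊢ᵐ a / x ≈ b / y → Hs ⊢ᵐ η a x' x →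
    Hs ⊢ᵐ ∃[ N ] (η (w1 b) v0 (w1 y) ∧ w1 a / w1 x' ≈ w1 b / v0)
  ≈-forth {a} {b} {x} {y} {x'} h k = ⇒E (⇒E (∀E* ≈-forth* (x' ,, y ,, x ,, b ,, a ,, ε)) h) k

  ≈-back : ∀ {a b x y y'} → Hs ⊢ᵐ a / x ≈ b / y → Hs ⊢ᵐ η b y' y →
    Hs ⊢ᵐ ∃[ N ] (η (w1 a) v0 (w1 x) ∧ w1 a / v0 ≈ w1 b / w1 y')
  ≈-back {a} {b} {x} {y} {y'} h k = ⇒E (⇒E (∀E* ≈-back* (y' ,, y ,, x ,, b ,, a ,, ε)) h) k

≈-/-refl* : ∀ {Γ Hs} → Hs ⊢ᵐ ∀* (N ∷ G ∷ []) {Γ} (v1 / v0 ≈ v1 / v0)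
≈-/-refl* = ∀I (∀I (conv (coinduction (v0 ≐ v1) ε ≐-refl
  (∃I v1 (∧I (≐-subst (η v1 v2 v0) (v4 ,, v1 ,, ε) (∧E₂ h0) (∧E₁ h0)) ≐-refl))
  (∃I v1 (∧I (≐-subst (η v1 v2 v0) (v4 ,, v1 ,, ε) (≐-sym (∧E₂ h0)) (∧E₁ h0)) ≐-refl)))
  (≡ᵐ-sym ≈/-≡ᵐ)))

-- The bisimulation is the converse one: `x` and `y` are related when `a / y ≈ b / x`, so the forth
-- and back properties exchange their roles.
≈-sym* : ∀ {Γ Hs} → Hs ⊢ᵐ ∀* (G ∷ G ∷ []) {Γ} (v1 ≈ v0 ⇒ v0 ≈ v1)
≈-sym* = ∀I (∀I (⇒I (conv (coinduction (v3 / v1 ≈ v2 / v0) (v0 ,, v1 ,, ε)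
  (conv h0 ≈-root-≡ᵐ)
  (≈-back (∧E₂ h0) (∧E₁ h0))
  (≈-forth (∧E₂ h0) (∧E₁ h0)))
  (≡ᵐ-sym ≈-≡ᵐ))))

≈-trans* : ∀ {Γ Hs} → Hs ⊢ᵐ ∀* (G ∷ G ∷ G ∷ []) {Γ} (v2 ≈ v1 ⇒ v1 ≈ v0 ⇒ v2 ≈ v0)
≈-trans* = ∀I (∀I (∀I (⇒I (⇒I (conv (coinduction
  -- Composition through a node of the middle graph; its parameters are the three graphs only, not
  -- the two given bisimulations.
  (∃[ N ] (v3 / v1 ≈ v4 / v0 ∧ v4 / v0 ≈ v5 / v2)) (v2 ,, v1 ,, v0 ,, ε)
  (∃I (root v1) (∧I (conv h1 ≈-root-≡ᵐ) (conv h0 ≈-root-≡ᵐ)))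
  (∃E (∧E₂ h0) (∃E (≈-forth (∧E₁ h0) (∧E₁ h1)) (∃E (≈-forth (∧E₂ h1) (∧E₁ h0))
    (∃I v0 (∧I (∧E₁ h0) (∃I v1 (∧I (∧E₂ h1) (∧E₂ h0))))))))
  (∃E (∧E₂ h0) (∃E (≈-back (∧E₂ h0) (∧E₁ h1)) (∃E (≈-back (∧E₁ h1) (∧E₁ h0))
    (∃I v0 (∧I (∧E₁ h0) (∃I v1 (∧I (∧E₂ h0) (∧E₂ h1)))))))))
  (≡ᵐ-sym ≈-≡ᵐ))))))

module _ {Γ} {Hs : List (Fm true Γ)} where

  ≈-/-refl : ∀ {a x} → Hs ⊢ᵐ a / x ≈ a / x
  ≈-/-refl {a} {x} = ∀E* ≈-/-refl* (x ,, a ,, ε)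

  ≈-refl : ∀ {a} → Hs ⊢ᵐ a ≈ a
  ≈-refl = conv ≈-/-refl (≡ᵐ-sym ≈-root-≡ᵐ)

  -- No rewrite rule relates `a` to `a / root a`, but this formula and the reflexivity of
  -- `a / root a` unfold to the same bisimilarity.
  ≈-/root : ∀ {a} → Hs ⊢ᵐ a ≈ a / root a
  ≈-/root = conv ≈-/-refl (≈/-≡ᵐ ◅◅ ≡ᵐ-sym ≈/ʳ-≡ᵐ)

  ≈-sym : ∀ {a b} → Hs ⊢ᵐ a ≈ b → Hs ⊢ᵐ b ≈ a
  ≈-sym {a} {b} h = ⇒E (∀E* ≈-sym* (b ,, a ,, ε)) h

  ≈-trans : ∀ {a b c} → Hs ⊢ᵐ a ≈ b → Hs ⊢ᵐ b ≈ c → Hs ⊢ᵐ a ≈ c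
  ≈-trans {a} {b} {c} h k = ⇒E (⇒E (∀E* ≈-trans* (c ,, b ,, a ,, ε)) h) k

-- Membership

Element : ∀ {Γ} → Tm true Γ G → Tm true Γ G → Tm true Γ N → Fm true Γ
Element c a z = ∃[ N ] (η (w1 a) v0 (w1 z) ∧ w1 c ≈ w1 a / v0)

∈-≡ᵐ : ∀ {Γ} {c a : Tm true Γ G} → (c ∈ᵍ a) ≡ᵐ Element c a (root a)
∈-≡ᵐ = ≡ᵐ-atom a-∈

-- All three rules for `/` act here: on the edges, on the root, and on the iterated `(a / z) / x`,
-- which collapses to `a / x`.
∈/-≡ᵐ : ∀ {Γ} {c a : Tm true Γ G} {z} → (c ∈ᵍ a / z) ≡ᵐ Element c a z
∈/-≡ᵐ {c = c} {a} = ∈-≡ᵐ ◅◅ cong-∃ (cong-∧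
  (≡ᵐ-atom a-η/ ◅◅ ≡ᵐ-term (η v1 v2 v0) (w1 a ,, v0 ,, ε) t-root/)
  (≡ᵐ-term (v1 ≈ v0) (w1 c ,, ε) t-//))

Element-intro* : ∀ {Γ Hs} → Hs ⊢ᵐ ∀* (N ∷ N ∷ G ∷ G ∷ []) {Γ} (η v2 v1 v0 ⇒ v3 ≈ v2 / v1 ⇒ Element v3 v2 v0)
Element-intro* = ∀I (∀I (∀I (∀I (⇒I (⇒I (∃I v1 (∧I h1 h0)))))))

module _ {Γ} {Hs : List (Fm true Γ)} where

  Element-intro : ∀ {a x z c} → Hs ⊢ᵐ η a x z → Hs ⊢ᵐ c ≈ a / x → Hs ⊢ᵐ Element c a z
  Element-intro {a} {x} {z} {c} h k = ⇒E (⇒E (∀E* Element-intro* (z ,, x ,, a ,, c ,, ε)) h) k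

  ∈-intro : ∀ {a x c} → Hs ⊢ᵐ η a x (root a) → Hs ⊢ᵐ c ≈ a / x → Hs ⊢ᵐ c ∈ᵍ a
  ∈-intro h k = conv (Element-intro h k) (≡ᵐ-sym ∈-≡ᵐ)

  ∈/-intro : ∀ {a x z c} → Hs ⊢ᵐ η a x z → Hs ⊢ᵐ c ≈ a / x → Hs ⊢ᵐ c ∈ᵍ a / z
  ∈/-intro h k = conv (Element-intro h k) (≡ᵐ-sym ∈/-≡ᵐ)

  ∈-elim : ∀ {a c} → Hs ⊢ᵐ c ∈ᵍ a → Hs ⊢ᵐ Element c a (root a)
  ∈-elim h = conv h ∈-≡ᵐ

  ∈/-elim : ∀ {a z c} → Hs ⊢ᵐ c ∈ᵍ a / z → Hs ⊢ᵐ Element c a z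
  ∈/-elim h = conv h ∈/-≡ᵐ

∈-respʳ* : ∀ {Γ Hs} → Hs ⊢ᵐ ∀* (G ∷ G ∷ G ∷ []) {Γ} (v2 ≈ v1 ⇒ v0 ∈ᵍ v2 ⇒ v0 ∈ᵍ v1)
∈-respʳ* = ∀I (∀I (∀I (⇒I (⇒I (∃E (∈-elim h0) (∃E (≈-forth (conv h2 ≈-root-≡ᵐ) (∧E₁ h0))
  (∈-intro (∧E₁ h0) (≈-trans (∧E₂ h1) (∧E₂ h0)))))))))

∈-respˡ* : ∀ {Γ Hs} → Hs ⊢ᵐ ∀* (G ∷ G ∷ G ∷ []) {Γ} (v2 ≈ v1 ⇒ v2 ∈ᵍ v0 ⇒ v1 ∈ᵍ v0)
∈-respˡ* = ∀I (∀I (∀I (⇒I (⇒I (∃E (∈-elim h0)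
  (∈-intro (∧E₁ h0) (≈-trans (≈-sym h2) (∧E₂ h0))))))))

module _ {Γ} {Hs : List (Fm true Γ)} where

  ∈-respʳ : ∀ {a b c} → Hs ⊢ᵐ a ≈ b → Hs ⊢ᵐ c ∈ᵍ a → Hs ⊢ᵐ c ∈ᵍ b
  ∈-respʳ {a} {b} {c} h k = ⇒E (⇒E (∀E* ∈-respʳ* (c ,, b ,, a ,, ε)) h) k

  ∈-respˡ : ∀ {a b c} → Hs ⊢ᵐ a ≈ b → Hs ⊢ᵐ a ∈ᵍ c → Hs ⊢ᵐ b ∈ᵍ c
  ∈-respˡ {a} {b} {c} h k = ⇒E (⇒E (∀E* ∈-respˡ* (c ,, b ,, a ,, ε)) h) k

-- The relation "a / x and b / y have the same elements" is a bisimulation.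
extensionality* : ∀ {Γ Hs} → Hs ⊢ᵐ ∀* (G ∷ G ∷ []) {Γ} ((∀[ G ] (v0 ∈ᵍ v2 ⇔ v0 ∈ᵍ v1)) ⇒ v1 ≈ v0)
extensionality* = ∀I (∀I (⇒I (conv (coinduction
  (∀[ G ] ((v0 ∈ᵍ v3 / v1 ⇒ v0 ∈ᵍ v4 / v2) ∧ (v0 ∈ᵍ v4 / v2 ⇒ v0 ∈ᵍ v3 / v1))) (v1 ,, v0 ,, ε)
  (∀I (∧I
    (⇒I (∈-respʳ ≈-/root (⇒E (∧E₁ (∀E h1 v0)) (∈-respʳ (≈-sym ≈-/root) h0))))
    (⇒I (∈-respʳ ≈-/root (⇒E (∧E₂ (∀E h1 v0)) (∈-respʳ (≈-sym ≈-/root) h0))))))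
  (∃E (∈/-elim (⇒E (∧E₁ (∀E (∧E₂ h0) (v4 / v1))) (∈/-intro (∧E₁ h0) ≈-/-refl)))
    (∃I v0 (∧I (∧E₁ h0) (∀I (∧I
      (⇒I (∈-respʳ (∧E₂ h1) h0))
      (⇒I (∈-respʳ (≈-sym (∧E₂ h1)) h0)))))))
  (∃E (∈/-elim (⇒E (∧E₂ (∀E (∧E₂ h0) (v3 / v1))) (∈/-intro (∧E₁ h0) ≈-/-refl)))
    (∃I v0 (∧I (∧E₁ h0) (∀I (∧I
      (⇒I (∈-respʳ (≈-sym (∧E₂ h1)) h0))
      (⇒I (∈-respʳ (∧E₂ h1) h0))))))))
  (≡ᵐ-sym ≈-≡ᵐ))))

module _ {Γ} {Hs : List (Fm true Γ)} where

  extensionality : ∀ {a b} → Hs ⊢ᵐ ∀[ G ] (v0 ∈ᵍ w1 a ⇔ v0 ∈ᵍ w1 b) → Hs ⊢ᵐ a ≈ b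
  extensionality {a} {b} h = ⇒E (∀E* extensionality* (b ,, a ,, ε)) h

-- Copies of a graph inside a constructed graph

common-j : ∀ {Γ} → Tm true Γ G → Tm true Γ N → Tm true Γ N → Fm true Γ
common-j a x x' = ∃[ N ] ∃[ N ] (w2 x ≐ jᵐ v1 ∧ w2 x' ≐ jᵐ v0 ∧ η (w2 a) v1 v0)

-- The graph of `iᵐ` is the bisimulation, injectivity of `iᵐ` giving the forth clause. Only edges
-- into nodes `iᵐ v` are constrained, not those into `oᵐ`; hence one lemma serves every constructor
-- that copies its argument.
embedding-i* : ∀ {Γ Hs} → Hs ⊢ᵐ ∀* (N ∷ G ∷ G ∷ []) {Γ}
  ((∀[ N ] ∀[ N ] (η v4 v1 (iᵐ v0) ⇔ common v3 v1 (iᵐ v0))) ⇒ v2 / iᵐ v0 ≈ v1 / v0)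
embedding-i* = ∀I (∀I (∀I (⇒I (conv (coinduction (v0 ≐ iᵐ v1) ε ≐-refl
  (cut (⇒E (∧E₁ (∀E (∀E h1 v1) v0)) (≐-subst (η v1 v2 v0) (v5 ,, v1 ,, ε) (∧E₂ h0) (∧E₁ h0)))
    (∃E h0 (∃E h0 (∃I v1 (∧I
      (≐-subst (η v1 v2 v0) (w2 v4 ,, v1 ,, ε) (≐-sym (iᵐ-injective (∧E₁ (∧E₂ h0)))) (∧E₂ (∧E₂ h0)))
      (∧E₁ h0))))))
  (∃I (iᵐ v1) (∧I
    (≐-subst (η v1 v2 v0) (v5 ,, iᵐ v1 ,, ε) (≐-sym (∧E₂ h0))
      (⇒E (∧E₂ (∀E (∀E h1 (iᵐ v1)) v2)) (∃I v1 (∃I v2 (∧I ≐-refl (∧I ≐-refl (∧E₁ h0)))))))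
    ≐-refl)))
  (≡ᵐ-sym ≈/-≡ᵐ)))))

embedding-j* : ∀ {Γ Hs} → Hs ⊢ᵐ ∀* (N ∷ G ∷ G ∷ []) {Γ}
  ((∀[ N ] ∀[ N ] (η v4 v1 (jᵐ v0) ⇔ common-j v3 v1 (jᵐ v0))) ⇒ v2 / jᵐ v0 ≈ v1 / v0)
embedding-j* = ∀I (∀I (∀I (⇒I (conv (coinduction (v0 ≐ jᵐ v1) ε ≐-refl
  (cut (⇒E (∧E₁ (∀E (∀E h1 v1) v0)) (≐-subst (η v1 v2 v0) (v5 ,, v1 ,, ε) (∧E₂ h0) (∧E₁ h0)))
    (∃E h0 (∃E h0 (∃I v1 (∧I
      (≐-subst (η v1 v2 v0) (w2 v4 ,, v1 ,, ε) (≐-sym (jᵐ-injective (∧E₁ (∧E₂ h0)))) (∧E₂ (∧E₂ h0)))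
      (∧E₁ h0))))))
  (∃I (jᵐ v1) (∧I
    (≐-subst (η v1 v2 v0) (v5 ,, jᵐ v1 ,, ε) (≐-sym (∧E₂ h0))
      (⇒E (∧E₂ (∀E (∀E h1 (jᵐ v1)) v2)) (∃I v1 (∃I v2 (∧I ≐-refl (∧I ≐-refl (∧E₁ h0)))))))
    ≐-refl)))
  (≡ᵐ-sym ≈/-≡ᵐ)))))

∈ᵒ-≡ᵐ : ∀ {Γ} {c a : Tm true Γ G} → root a ↦ᵗ oᵐ → (c ∈ᵍ a) ≡ᵐ Element c a oᵐ
∈ᵒ-≡ᵐ {c = c} {a} r = ∈-≡ᵐ ◅◅ ≡ᵐ-term (Element v1 v2 v0) (c ,, a ,, ε) r

module _ {Γ} {Hs : List (Fm true Γ)} where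

  embedding-i : ∀ {e a u} →
    (η (w2 e) v1 (iᵐ v0) ∷ wHs (wHs Hs)) ⊢ᵐ common (w2 a) v1 (iᵐ v0) →
    (common (w2 a) v1 (iᵐ v0) ∷ wHs (wHs Hs)) ⊢ᵐ η (w2 e) v1 (iᵐ v0) →
    Hs ⊢ᵐ e / iᵐ u ≈ a / u
  embedding-i {e} {a} {u} h k = ⇒E (∀E* embedding-i* (u ,, a ,, e ,, ε)) (∀I (∀I (∧I (⇒I h) (⇒I k))))

  embedding-j : ∀ {e a u} →
    (η (w2 e) v1 (jᵐ v0) ∷ wHs (wHs Hs)) ⊢ᵐ common-j (w2 a) v1 (jᵐ v0) →
    (common-j (w2 a) v1 (jᵐ v0) ∷ wHs (wHs Hs)) ⊢ᵐ η (w2 e) v1 (jᵐ v0) →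
    Hs ⊢ᵐ e / jᵐ u ≈ a / u
  embedding-j {e} {a} {u} h k = ⇒E (∀E* embedding-j* (u ,, a ,, e ,, ε)) (∀I (∀I (∧I (⇒I h) (⇒I k))))

  ∈ᵒ-intro : ∀ {a x c} → root a ↦ᵗ oᵐ → Hs ⊢ᵐ η a x oᵐ → Hs ⊢ᵐ c ≈ a / x → Hs ⊢ᵐ c ∈ᵍ a
  ∈ᵒ-intro r h k = conv (Element-intro h k) (≡ᵐ-sym (∈ᵒ-≡ᵐ r))

  ∈ᵒ-elim : ∀ {a c} → root a ↦ᵗ oᵐ → Hs ⊢ᵐ c ∈ᵍ a → Hs ⊢ᵐ Element c a oᵐ
  ∈ᵒ-elim r h = conv h (∈ᵒ-≡ᵐ r)

  common-o-absurd : ∀ {a x D} → Hs ⊢ᵐ common a x oᵐ → Hs ⊢ᵐ D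
  common-o-absurd h = ∃E h (∃E h0 (i≐o-absurd (≐-sym (∧E₁ (∧E₂ h0)))))

  ≈-/-subst : ∀ {c a x y} → Hs ⊢ᵐ x ≐ y → Hs ⊢ᵐ c ≈ a / x → Hs ⊢ᵐ c ≈ a / y
  ≈-/-subst {c} {a} = ≐-subst (v1 ≈ v2 / v0) (c ,, a ,, ε)

  -- Leibniz replacement concerns nodes, so the graph is read back from its code: the transported
  -- property is membership in `ρ' v0`.
  ∈-ρ-subst : ∀ {c a b} → Hs ⊢ᵐ ρ a ≐ ρ b → Hs ⊢ᵐ c ∈ᵍ a → Hs ⊢ᵐ c ∈ᵍ b
  ∈-ρ-subst {c} e h =
    conv (≐-subst (v1 ∈ᵍ ρ' v0) (c ,, ε) e (conv h (≡ᵐ-sym (≡ᵐ-term (v1 ∈ᵍ v0) (c ,, ε) t-ρ'ρ))))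
      (≡ᵐ-term (v1 ∈ᵍ v0) (c ,, ε) t-ρ'ρ)

  -- Here and for the other constructors, each disjunct of the edge rule besides the copied edges
  -- has its target at `oᵐ` or at a node `jᵐ v`, never at `iᵐ v`.
  pair-i : ∀ {a b u} → Hs ⊢ᵐ pair a b / iᵐ u ≈ a / u
  pair-i = embedding-i
    (∨E (unfold a-ηpair h0) h0
      (∨E h0 (∃E h0 (∃E h0 (i≐j-absurd (∧E₁ (∧E₂ h0)))))
        (∨E h0 (i≐o-absurd (∧E₂ h0)) (i≐o-absurd (∧E₂ h0)))))
    (fold a-ηpair (∨I₁ h0))

  pair-j : ∀ {a b u} → Hs ⊢ᵐ pair a b / jᵐ u ≈ b / u
  pair-j = embedding-j
    (∨E (unfold a-ηpair h0) (∃E h0 (∃E h0 (i≐j-absurd (≐-sym (∧E₁ (∧E₂ h0))))))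
      (∨E h0 h0 (∨E h0 (j≐o-absurd (∧E₂ h0)) (j≐o-absurd (∧E₂ h0)))))
    (fold a-ηpair (∨I₂ (∨I₁ h0)))

  ⋃-i : ∀ {a u} → Hs ⊢ᵐ ⋃ a / iᵐ u ≈ a / u
  ⋃-i = embedding-i
    (∨E (unfold a-η⋃ h0) h0 (∃E h0 (∃E h0 (i≐o-absurd (∧E₁ (∧E₂ h0))))))
    (fold a-η⋃ (∨I₁ h0))

  𝒫-i : ∀ {a u} → Hs ⊢ᵐ 𝒫 a / iᵐ u ≈ a / u
  𝒫-i = embedding-i
    (∨E (unfold a-η𝒫 h0) h0
      (∨E h0 (∃E h0 (∃E h0 (i≐j-absurd (∧E₁ (∧E₂ h0))))) (∃E h0 (i≐o-absurd (∧E₂ h0)))))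
    (fold a-η𝒫 (∨I₁ h0))

  f-i : ∀ {n} {P : Fmˢ (suc n)} {ys a u} → Hs ⊢ᵐ f P ys a / iᵐ u ≈ a / u
  f-i = embedding-i
    (∨E (unfold a-ηf h0) h0 (∃E h0 (i≐o-absurd (∧E₁ (∧E₂ h0)))))
    (fold a-ηf (∨I₁ h0))

  Cl-i : ∀ {a u} → Hs ⊢ᵐ Cl a / iᵐ u ≈ a / u
  Cl-i = embedding-i
    (∨E (unfold a-ηCl h0) h0 (∃E h0 (i≐o-absurd (∧E₁ (∧E₂ h0)))))
    (fold a-ηCl (∨I₁ h0))

-- The axioms

-- Arbitrary contexts and hypotheses let an axiom be used anywhere in a derivation. The assignment
-- is arbitrary because functions out of `Fin 0` are not definitionally equal.
Valid : Fmˢ 0 → Set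
Valid A = ∀ {Γ} {Hs : List (Fm true Γ)} (σ : Fin 0 → Tm true Γ G) → Hs ⊢ᵐ tr A σ

pairing : Valid (∀ˢ (∀ˢ (∃ˢ (∀ˢ (x0 ∈ˢ x1 ⇔ˢ (x0 ≐ˢ x3 ∨ˢ x0 ≐ˢ x2))))))
pairing σ = ∀I (∀I (∃I (pair v1 v0) (∀I (∧I
  (⇒I (∃E (∈ᵒ-elim t-rootpr h0) (∨E (unfold a-ηpair (∧E₁ h0))
    (common-o-absurd h0)
    (∨E h0 (∃E h0 (∃E h0 (j≐o-absurd (≐-sym (∧E₁ (∧E₂ h0))))))
      (∨E h0
        (∨I₁ (≈-trans (≈-/-subst (∧E₁ h0) (∧E₂ h3)) (≈-trans pair-i (≈-sym ≈-/root))))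
        (∨I₂ (≈-trans (≈-/-subst (∧E₁ h0) (∧E₂ h3)) (≈-trans pair-j (≈-sym ≈-/root)))))))))
  (⇒I (∨E h0
    (∈ᵒ-intro {x = iᵐ (root v2)} t-rootpr (fold a-ηpair (∨I₂ (∨I₂ (∨I₁ (∧I ≐-refl ≐-refl)))))
      (≈-trans h0 (≈-trans ≈-/root (≈-sym pair-i))))
    (∈ᵒ-intro {x = jᵐ (root v1)} t-rootpr (fold a-ηpair (∨I₂ (∨I₂ (∨I₂ (∧I ≐-refl ≐-refl)))))
      (≈-trans h0 (≈-trans ≈-/root (≈-sym pair-j))))))))))

union : Valid (∀ˢ (∃ˢ (∀ˢ (x0 ∈ˢ x1 ⇔ˢ ∃ˢ (x1 ∈ˢ x0 ∧ˢ x0 ∈ˢ x3)))))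
union σ = ∀I (∃I (⋃ v0) (∀I (∧I
  (⇒I (∃E (∈ᵒ-elim t-root⋃ h0) (∨E (unfold a-η⋃ (∧E₁ h0))
    (common-o-absurd h0)
    -- The intermediate set is `a / z`, for the middle node `z` of the path of length two that ends
    -- in the root of `a`.
    (∃E h0 (∃E h0 (∃I (v4 / v0) (∧I
      (∈/-intro (∧E₁ (∧E₂ (∧E₂ h0))) (≈-trans (≈-/-subst (∧E₁ h0) (∧E₂ h3)) ⋃-i))
      (∈-intro (∧E₂ (∧E₂ (∧E₂ h0))) ≈-refl))))))))
  (⇒I (∃E h0 (∃E (∈-elim (∧E₂ h0)) (∃E (∈/-elim (∈-respʳ (∧E₂ h0) (∧E₁ h1)))
    (∈ᵒ-intro {x = iᵐ v0} t-root⋃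
      (fold a-η⋃ (∨I₂ (∃I v0 (∃I v1 (∧I ≐-refl (∧I ≐-refl (∧I (∧E₁ h0) (∧E₁ h1))))))))
      (≈-trans (∧E₂ h0) (≈-sym ⋃-i))))))))))

-- The node j(ρ(c)) of 𝒫(a) represents c ∩ a.
𝒫-j* : ∀ {Γ Hs} → Hs ⊢ᵐ ∀* (G ∷ G ∷ G ∷ []) {Γ} (v0 ∈ᵍ 𝒫 v2 / jᵐ (ρ v1) ⇔ (v0 ∈ᵍ v1 ∧ v0 ∈ᵍ v2))
𝒫-j* = ∀I (∀I (∀I (∧I
  (⇒I (∃E (∈/-elim h0) (∨E (unfold a-η𝒫 (∧E₁ h0))
    (∃E h0 (∃E h0 (i≐j-absurd (≐-sym (∧E₁ (∧E₂ h0))))))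
    (∨E h0
      (∃E h0 (∃E h0 (cut (≈-trans (≈-/-subst (∧E₁ h0) (∧E₂ h4)) 𝒫-i) (∧I
        (∈-respˡ (≈-sym h0) (∈-ρ-subst (≐-sym (jᵐ-injective (∧E₁ (∧E₂ h1)))) (∧E₂ (∧E₂ (∧E₂ h1)))))
        (∈-intro (∧E₁ (∧E₂ (∧E₂ h1))) h0)))))
      (∃E h0 (j≐o-absurd (∧E₂ h0)))))))
  (⇒I (∃E (∈-elim (∧E₂ h0)) (∈/-intro {x = iᵐ v0}
    (fold a-η𝒫 (∨I₂ (∨I₁ (∃I v0 (∃I v2 (∧I ≐-refl (∧I ≐-refl (∧I (∧E₁ h0) (∈-respˡ (∧E₂ h0) (∧E₁ h1))))))))))
    (≈-trans (∧E₂ h0) (≈-sym 𝒫-i))))))))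

𝒫-j : ∀ {Γ Hs} {a c u : Tm true Γ G} → Hs ⊢ᵐ u ∈ᵍ 𝒫 a / jᵐ (ρ c) ⇔ (u ∈ᵍ c ∧ u ∈ᵍ a)
𝒫-j {a = a} {c} {u} = ∀E* 𝒫-j* (u ,, c ,, a ,, ε)

powerset : Valid (∀ˢ (∃ˢ (∀ˢ (x0 ∈ˢ x1 ⇔ˢ Subsetˢ x0 x2))))
powerset σ = ∀I (∃I (𝒫 v0) (∀I (∧I
  (⇒I (∀I (⇒I (∃E (∈ᵒ-elim t-root𝒫 h1) (∨E (unfold a-η𝒫 (∧E₁ h0))
    (common-o-absurd h0)
    (∨E h0
      (∃E h0 (∃E h0 (j≐o-absurd (≐-sym (∧E₁ (∧E₂ h0))))))
      (∃E h0 (∧E₂ (⇒E (∧E₁ 𝒫-j) (∈-respʳ (≈-/-subst (∧E₁ h0) (∧E₂ h3)) h4))))))))))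
  -- The node coding the subset itself: its intersection with `a` has the same elements as the
  -- subset, by the inclusion hypothesis.
  (⇒I (∈ᵒ-intro {x = jᵐ (ρ v0)} t-root𝒫
    (fold a-η𝒫 (∨I₂ (∨I₂ (∃I v0 (∧I ≐-refl ≐-refl)))))
    (extensionality (∀I (∧I
      (⇒I (⇒E (∧E₂ 𝒫-j) (∧I h0 (⇒E (∀E h1 v0) h0))))
      (⇒I (∧E₁ (⇒E (∧E₁ 𝒫-j) h0)))))))))))

-- `Ω / iᵐ n` plays the von Neumann numeral of `n`: its elements are the `Ω / iᵐ m` with `m <ᵐ n`.
Ω-elim* : ∀ {Γ Hs} → Hs ⊢ᵐ ∀* (N ∷ G ∷ []) {Γ} (v1 ∈ᵍ Ω / iᵐ v0 ⇒ ∃[ N ] (v0 <ᵐ v1 ∧ v2 ≈ Ω / iᵐ v0))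
Ω-elim* = ∀I (∀I (⇒I (∃E (∈/-elim h0) (∨E (unfold a-ηΩ (∧E₁ h0))
  (∃E h0 (∃E h0 (∃I v1 (∧I
    (≐-subst (v1 <ᵐ v0) (v1 ,, ε) (≐-sym (iᵐ-injective (∧E₁ (∧E₂ h0)))) (∧E₂ (∧E₂ h0)))
    (≈-/-subst (∧E₁ h0) (∧E₂ h3))))))
  (∃E h0 (i≐o-absurd (∧E₁ (∧E₂ h0))))))))

Ω-intro* : ∀ {Γ Hs} → Hs ⊢ᵐ ∀* (N ∷ N ∷ G ∷ []) {Γ} (v1 <ᵐ v0 ⇒ v2 ≈ Ω / iᵐ v1 ⇒ v2 ∈ᵍ Ω / iᵐ v0)
Ω-intro* = ∀I (∀I (∀I (⇒I (⇒I (∈/-intro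
  (fold a-ηΩ (∨I₁ (∃I v1 (∃I v0 (∧I ≐-refl (∧I ≐-refl h1)))))) h0)))))

module _ {Γ} {Hs : List (Fm true Γ)} where

  Ω-elim : ∀ {c n} → Hs ⊢ᵐ c ∈ᵍ Ω / iᵐ n → Hs ⊢ᵐ ∃[ N ] (v0 <ᵐ w1 n ∧ w1 c ≈ Ω / iᵐ v0)
  Ω-elim {c} {n} h = ⇒E (∀E* Ω-elim* (n ,, c ,, ε)) h

  Ω-intro : ∀ {c m n} → Hs ⊢ᵐ m <ᵐ n → Hs ⊢ᵐ c ≈ Ω / iᵐ m → Hs ⊢ᵐ c ∈ᵍ Ω / iᵐ n
  Ω-intro {c} {m} {n} h k = ⇒E (⇒E (∀E* Ω-intro* (n ,, m ,, c ,, ε)) h) k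

infinity : Valid (∃ˢ (Indˢ x0))
infinity σ = ∃I Ω (∧I
  (∀I (⇒I (∈ᵒ-intro {x = iᵐ 0ᵐ} t-rootΩ
    (fold a-ηΩ (∨I₂ (∃I 0ᵐ (∧I ≐-refl (∧I ≐-refl (fold a-Nat0 ⊤I))))))
    (extensionality (∀I (∧I
      (⇒I (⊥E (⇒E (∀E h1 v0) h0)))
      (⇒I (∃E (Ω-elim h0) (⊥E (unfold a-<0 (∧E₁ h0)))))))))))
  (∀I (⇒I (∀I (⇒I (∃E (∈ᵒ-elim t-rootΩ h1) (∨E (unfold a-ηΩ (∧E₁ h0))
    (∃E h0 (∃E h0 (i≐o-absurd (≐-sym (∧E₁ (∧E₂ h0))))))
    (∃E h0 (cut (≈-/-subst (∧E₁ h0) (∧E₂ h2))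
      -- If `a ≈ Ω / iᵐ n`, its successor has the elements of `Ω / iᵐ (Sᵐ n)`, since `m <ᵐ Sᵐ n`
      -- rewrites to `m <ᵐ n ∨ m ≐ n`.
      (∈ᵒ-intro {x = iᵐ (Sᵐ v0)} t-rootΩ
        (fold a-ηΩ (∨I₂ (∃I (Sᵐ v0) (∧I ≐-refl (∧I ≐-refl (fold a-NatS (∧E₂ (∧E₂ h1))))))))
        (extensionality (∀I (∧I
          (⇒I (∨E (⇒E (∧E₁ (∀E h5 v0)) h0)
            (∃E (Ω-elim (∈-respʳ h2 h0)) (Ω-intro (fold a-<S (∨I₁ (∧E₁ h0))) (∧E₂ h0)))
            (Ω-intro (fold a-<S (∨I₂ ≐-refl)) (≈-trans h0 h2))))
          (⇒I (∃E (Ω-elim h0) (∨E (unfold a-<S (∧E₁ h0))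
            (⇒E (∧E₂ (∀E h7 v1)) (∨I₁ (∈-respʳ (≈-sym h3) (Ω-intro h0 (∧E₂ h1)))))
            (⇒E (∧E₂ (∀E h7 v1)) (∨I₂ (≈-trans (≐-subst (v1 ≈ Ω / iᵐ v0) (v1 ,, ε) h0 (∧E₂ h1)) (≈-sym h3))))))))))))))))))))

-- The edges of `Cl a` into `oᵐ` come from the nodes lying in every class that contains the children
-- of the root of `a` and is closed under passing to children. The first condition yields inclusion,
-- the second transitivity.
transitive-closure : Valid (∀ˢ (∃ˢ (Subsetˢ x1 x0 ∧ˢ ∀ˢ (∀ˢ ((x1 ∈ˢ x0 ∧ˢ x0 ∈ˢ x2) ⇒ˢ x1 ∈ˢ x2)))))
transitive-closure σ = ∀I (∃I (Cl v0) (∧I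
  (∀I (⇒I (∃E (∈-elim h0) (∈ᵒ-intro {x = iᵐ v0} t-rootCl
    (fold a-ηCl (∨I₂ (∃I v0 (∧I ≐-refl (∧I ≐-refl (∀I (⇒I (⇒E (∀E (∧E₁ h0) v1) (∧E₁ h1)))))))))
    (≈-trans (∧E₂ h0) (≈-sym Cl-i))))))
  (∀I (∀I (⇒I (∃E (∈ᵒ-elim t-rootCl (∧E₂ h0)) (∨E (unfold a-ηCl (∧E₁ h0))
    (common-o-absurd h0)
    (∃E h0 (∃E (∈/-elim (∈-respʳ (≈-trans (≈-/-subst (∧E₁ h0) (∧E₂ h2)) Cl-i) (∧E₁ h3)))
      (∈ᵒ-intro {x = iᵐ v0} t-rootCl
        (fold a-ηCl (∨I₂ (∃I v0 (∧I ≐-refl (∧I ≐-refl (∀I (⇒I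
          (⇒E (∀E (∀E (∧E₂ h0) v1) v2)
            (∧I (∧E₁ h1) (⇒E (∀E (∧E₂ (∧E₂ h2)) v0) h0))))))))))
        (≈-trans (∧E₂ h0) (≈-sym Cl-i)))))))))))
  )

-- The translation commutes with substitution

subT-extG : ∀ {b Γ Δ n} {σ : Sub b Γ Δ} {τ : Fin n → Tm b Γ G} {υ : Fin n → Tm b Δ G} →
  subT σ ∘ τ ≗ υ → subT (liftS σ) ∘ extG τ ≗ extG υ
subT-extG e zero = refl
subT-extG {τ = τ} e (suc k) = trans (subT-w1 (τ k)) (trans (sym (w1-subT (τ k))) (cong w1 (e k)))

subF-tr : ∀ {b Γ Δ n} (A : Fmˢ n) {σ : Sub b Γ Δ} {τ : Fin n → Tm b Γ G} {υ : Fin n → Tm b Δ G} →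
  subT σ ∘ τ ≗ υ → subF σ (tr A τ) ≡ tr A υ
subF-tr (x ≐ˢ y) e = cong₂ _≈_ (e x) (e y)
subF-tr (x ∈ˢ y) e = cong₂ _∈ᵍ_ (e x) (e y)
subF-tr ⊤ˢ e = refl
subF-tr ⊥ˢ e = refl
subF-tr (A ∧ˢ B) e = cong₂ _∧_ (subF-tr A e) (subF-tr B e)
subF-tr (A ∨ˢ B) e = cong₂ _∨_ (subF-tr A e) (subF-tr B e)
subF-tr (A ⇒ˢ B) e = cong₂ _⇒_ (subF-tr A e) (subF-tr B e)
subF-tr (∀ˢ A) e = cong ∀[ G ]_ (subF-tr A (subT-extG e))
subF-tr (∃ˢ A) e = cong ∃[ G ]_ (subF-tr A (subT-extG e))

tr-cong : ∀ {b Γ n} (A : Fmˢ n) {σ τ : Fin n → Tm b Γ G} → σ ≗ τ → tr A σ ≡ tr A τ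
tr-cong A {σ} e = trans (sym (subF-id (λ _ → refl) (tr A σ)))
  (subF-tr A λ k → trans (subT-id (λ _ → refl) (σ k)) (e k))

renF-tr : ∀ {b Γ Δ n} (A : Fmˢ n) {r : Ren Γ Δ} {τ : Fin n → Tm b Γ G} {υ : Fin n → Tm b Δ G} →
  renT r ∘ τ ≗ υ → renF r (tr A τ) ≡ tr A υ
renF-tr A {τ = τ} e = trans (renF≡subF (λ _ → refl) (tr A τ))
  (subF-tr A λ k → trans (sym (renT≡subT (λ _ → refl) (τ k))) (e k))

extG-liftˢ : ∀ {b Γ n m} {r : Fin n → Fin m} {σ : Fin m → Tm b Γ G} {υ : Fin n → Tm b Γ G} →
  σ ∘ r ≗ υ → extG σ ∘ liftˢ r ≗ extG υ
extG-liftˢ e zero = refl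
extG-liftˢ e (suc k) = cong w1 (e k)

tr-renˢ : ∀ {b Γ n m} (A : Fmˢ n) {r : Fin n → Fin m} {σ : Fin m → Tm b Γ G} {υ : Fin n → Tm b Γ G} →
  σ ∘ r ≗ υ → tr (renˢ r A) σ ≡ tr A υ
tr-renˢ (x ≐ˢ y) e = cong₂ _≈_ (e x) (e y)
tr-renˢ (x ∈ˢ y) e = cong₂ _∈ᵍ_ (e x) (e y)
tr-renˢ ⊤ˢ e = refl
tr-renˢ ⊥ˢ e = refl
tr-renˢ (A ∧ˢ B) e = cong₂ _∧_ (tr-renˢ A e) (tr-renˢ B e)
tr-renˢ (A ∨ˢ B) e = cong₂ _∨_ (tr-renˢ A e) (tr-renˢ B e)
tr-renˢ (A ⇒ˢ B) e = cong₂ _⇒_ (tr-renˢ A e) (tr-renˢ B e)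
tr-renˢ (∀ˢ A) e = cong ∀[ G ]_ (tr-renˢ A (extG-liftˢ e))
tr-renˢ (∃ˢ A) e = cong ∃[ G ]_ (tr-renˢ A (extG-liftˢ e))

embT-extG : ∀ {Γ n} {σ : Fin n → Tm false Γ G} {υ : Fin n → Tm true Γ G} →
  embT ∘ σ ≗ υ → embT ∘ extG σ ≗ extG υ
embT-extG e zero = refl
embT-extG {σ = σ} e (suc k) = trans (embT-w1 (σ k)) (cong w1 (e k))

embF-tr : ∀ {Γ n} (A : Fmˢ n) {σ : Fin n → Tm false Γ G} {υ : Fin n → Tm true Γ G} →
  embT ∘ σ ≗ υ → embF (tr A σ) ≡ tr A υ
embF-tr (x ≐ˢ y) e = cong₂ _≈_ (e x) (e y)
embF-tr (x ∈ˢ y) e = cong₂ _∈ᵍ_ (e x) (e y)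
embF-tr ⊤ˢ e = refl
embF-tr ⊥ˢ e = refl
embF-tr (A ∧ˢ B) e = cong₂ _∧_ (embF-tr A e) (embF-tr B e)
embF-tr (A ∨ˢ B) e = cong₂ _∨_ (embF-tr A e) (embF-tr B e)
embF-tr (A ⇒ˢ B) e = cong₂ _⇒_ (embF-tr A e) (embF-tr B e)
embF-tr (∀ˢ A) e = cong ∀[ G ]_ (embF-tr A (embT-extG e))
embF-tr (∃ˢ A) e = cong ∃[ G ]_ (embF-tr A (embT-extG e))

cast : ∀ {Γ Hs} {A B : Fm true Γ} → A ≡ B → Hs ⊢ᵐ A → Hs ⊢ᵐ B
cast refl h = h

-- Translated formulas respect ≈

-- Invariance is proved by induction through quantifiers and implications, which enlarge context and
-- hypotheses. Equations given by membership in the hypothesis list survive this, whereas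
-- derivations would have to be weakened. `flipped` serves the premise of an implication, where the
-- direction reverses.
data Assumed {Γ} (Hs : List (Fm true Γ)) (t u : Tm true Γ G) : Set where
  same   : t ≡ u → Assumed Hs t u
  direct : (t ≈ u) ∈ᴸ Hs → Assumed Hs t u
  flipped : (u ≈ t) ∈ᴸ Hs → Assumed Hs t u

module _ {Γ} {Hs : List (Fm true Γ)} where

  Assumed-sym : ∀ {t u} → Assumed Hs t u → Assumed Hs u t
  Assumed-sym (same refl) = same refl
  Assumed-sym (direct m) = flipped m
  Assumed-sym (flipped m) = direct m

  Assumed-∷ : ∀ {A t u} → Assumed Hs t u → Assumed (A ∷ Hs) t u
  Assumed-∷ (same e) = same e
  Assumed-∷ (direct m) = direct (thereᴸ m)
  Assumed-∷ (flipped m) = flipped (thereᴸ m)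

  Assumed-≈ : ∀ {t u} → Assumed Hs t u → Hs ⊢ᵐ t ≈ u
  Assumed-≈ (same refl) = ≈-refl
  Assumed-≈ (direct m) = hyp m
  Assumed-≈ (flipped m) = ≈-sym (hyp m)

  Assumed-w1 : ∀ {t u s} → Assumed Hs t u → Assumed (wHs {s = s} Hs) (w1 t) (w1 u)
  Assumed-w1 (same e) = same (cong w1 e)
  Assumed-w1 (direct m) = direct (∈-map⁺ (renF there) m)
  Assumed-w1 (flipped m) = flipped (∈-map⁺ (renF there) m)

  Assumed-extG : ∀ {n} {σ τ : Fin n → Tm true Γ G} → (∀ k → Assumed Hs (σ k) (τ k)) →
    ∀ k → Assumed (wHs Hs) (extG σ k) (extG τ k)
  Assumed-extG e zero = same refl
  Assumed-extG e (suc k) = Assumed-w1 (e k)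

renF-liftR-there-[] : ∀ {Γ s} (A : Fm true (s ∷ Γ)) → renF (liftR there) A [ v0 ] ≡ A
renF-liftR-there-[] A = trans (cong (subF _) (renF≡subF (λ _ → refl) A))
  (trans (subF-subF {υ = var} (λ { here → refl ; (there _) → refl }) A) (subF-id (λ _ → refl) A))

∃-map : ∀ {Γ s} {Hs : List (Fm true Γ)} {A B : Fm true (s ∷ Γ)} →
  Hs ⊢ᵐ ∃[ s ] A → (A ∷ wHs Hs) ⊢ᵐ B → Hs ⊢ᵐ ∃[ s ] B
∃-map {B = B} h k = ∃E h (∃I v0 (cast (sym (renF-liftR-there-[] B)) k))

tr-resp : ∀ {Γ n} {Hs : List (Fm true Γ)} (A : Fmˢ n) {σ τ : Fin n → Tm true Γ G} →
  (∀ k → Assumed Hs (σ k) (τ k)) → Hs ⊢ᵐ tr A σ ⇒ tr A τ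
tr-resp (x ≐ˢ y) e = ⇒I (≈-trans (≈-sym (Assumed-≈ (Assumed-∷ (e x)))) (≈-trans h0 (Assumed-≈ (Assumed-∷ (e y)))))
tr-resp (x ∈ˢ y) e = ⇒I (∈-respˡ (Assumed-≈ (Assumed-∷ (e x))) (∈-respʳ (Assumed-≈ (Assumed-∷ (e y))) h0))
tr-resp ⊤ˢ e = ⇒I ⊤I
tr-resp ⊥ˢ e = ⇒I h0
tr-resp (A ∧ˢ B) e = ⇒I (∧I (⇒E (tr-resp A (Assumed-∷ ∘ e)) (∧E₁ h0)) (⇒E (tr-resp B (Assumed-∷ ∘ e)) (∧E₂ h0)))
tr-resp (A ∨ˢ B) e = ⇒I (∨E h0
  (∨I₁ (⇒E (tr-resp A (Assumed-∷ ∘ Assumed-∷ ∘ e)) h0))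
  (∨I₂ (⇒E (tr-resp B (Assumed-∷ ∘ Assumed-∷ ∘ e)) h0)))
tr-resp (A ⇒ˢ B) e = ⇒I (⇒I (⇒E (tr-resp B (Assumed-∷ ∘ Assumed-∷ ∘ e))
  (⇒E h1 (⇒E (tr-resp A (Assumed-∷ ∘ Assumed-∷ ∘ Assumed-sym ∘ e)) h0))))
tr-resp (∀ˢ A) e = ⇒I (∀I (⇒E (tr-resp A (Assumed-∷ ∘ Assumed-extG e)) (cast (renF-liftR-there-[] _) (∀E h0 v0))))
tr-resp (∃ˢ A) e = ⇒I (∃-map h0 (⇒E (tr-resp A (Assumed-∷ ∘ Assumed-extG (Assumed-∷ ∘ e))) h0))

-- Schema formulas

appᵗ : ∀ {b Γ k} → (Fin k → Tm b Γ G) → Tm b Γ G → Tm b Γ G → Fin (suc (suc k)) → Tm b Γ G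
appᵗ p c d zero = d
appᵗ p c d (suc zero) = c
appᵗ p c d (suc (suc l)) = p l

-- With `k` unknown the parameters cannot be listed as concrete variables. Taking them as positions
-- keeps weakening manageable: renaming a position is function application.
App : ∀ {Γ k} → Fmˢ (suc (suc k)) → (Fin k → Γ ∋ G) → Tm true Γ G → Tm true Γ G → Fm true Γ
App Q p c d = tr Q (appᵗ (λ l → var (p l)) c d)

renF-App : ∀ {Γ Δ k} (Q : Fmˢ (suc (suc k))) (r : Ren Γ Δ) {p c d} →
  renF r (App Q p c d) ≡ App Q (λ l → r (p l)) (renT r c) (renT r d)
renF-App Q r = renF-tr Q λ { zero → refl ; (suc zero) → refl ; (suc (suc l)) → refl }

subF-App : ∀ {Γ Δ k} (Q : Fmˢ (suc (suc k))) (σ : Sub true Γ Δ) {p p' c d} → (∀ l → σ (p l) ≡ var (p' l)) →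
  subF σ (App Q p c d) ≡ App Q p' (subT σ c) (subT σ d)
subF-App Q σ e = subF-tr Q λ { zero → refl ; (suc zero) → refl ; (suc (suc l)) → e l }

-- The equation is turned into a hypothesis by a cut, as `Assumed` requires.
App-resp : ∀ {Γ k} {Hs : List (Fm true Γ)} (Q : Fmˢ (suc (suc k))) {p c d d'} →
  Hs ⊢ᵐ d ≈ d' → Hs ⊢ᵐ App Q p c d → Hs ⊢ᵐ App Q p c d'
App-resp Q e h = ⇒E (⇒E (⇒I (tr-resp Q
  λ { zero → direct (hereᴸ refl) ; (suc zero) → same refl ; (suc (suc l)) → same refl })) e) h

tr-Rapp : ∀ {Γ k m} (Q : Fmˢ (suc (suc k))) {q : Fin k → Fin m} {σ : Fin m → Tm true Γ G} {u v} {p : Fin k → Γ ∋ G} →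
  (∀ l → σ (q l) ≡ var (p l)) → tr (Rapp Q q u v) σ ≡ App Q p (σ u) (σ v)
tr-Rapp Q e = tr-renˢ Q λ { zero → refl ; (suc zero) → refl ; (suc (suc l)) → e l }

extV : ∀ {Γ n} → (Fin n → Γ ∋ G) → Fin (suc n) → (G ∷ Γ) ∋ G
extV ν zero = here
extV ν (suc l) = there (ν l)

allsˢ-valid : ∀ k {n} {A : Fmˢ (k + n)} →
  (∀ {Γ} {Hs : List (Fm true Γ)} (ν : Fin (k + n) → Γ ∋ G) → Hs ⊢ᵐ tr A (λ l → var (ν l))) →
  ∀ {Γ} {Hs : List (Fm true Γ)} (ν : Fin n → Γ ∋ G) → Hs ⊢ᵐ tr (allsˢ k A) (λ l → var (ν l))
allsˢ-valid zero h = h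
allsˢ-valid (suc k) {A = A} h = allsˢ-valid k λ ν →
  ∀I (cast (tr-cong A λ { zero → refl ; (suc l) → refl }) (h (extV ν)))

params : ∀ {Γ k} → (Fin k → Γ ∋ G) → Tms true Γ (replicate k G)
params {k = zero} p = ε
params {k = suc k} p = var (p zero) ,, params (λ l → p (suc l))

renTs-params : ∀ {Γ Δ k} (r : Ren Γ Δ) (p : Fin k → Γ ∋ G) → renTs r (params p) ≡ params (λ l → r (p l))
renTs-params {k = zero} r p = refl
renTs-params {k = suc k} r p = cong (_ ,,_) (renTs-params r (λ l → p (suc l)))

lookupG-params : ∀ {Γ k} (p : Fin k → Γ ∋ G) l → lookupG (params p) l ≡ var (p l)
lookupG-params p zero = refl
lookupG-params p (suc l) = lookupG-params (λ l → p (suc l)) l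

lookupG-wTs-wTs-params : ∀ {Γ k s t} (p : Fin k → Γ ∋ G) l →
  lookupG (wTs {t = t} (wTs {t = s} (params p))) l ≡ var (there (there (p l)))
lookupG-wTs-wTs-params p l = trans
  (cong (λ ts → lookupG ts l) (trans (cong wTs (renTs-params there p)) (renTs-params there _)))
  (lookupG-params _ l)

-- Restricted comprehension

comprehension : ∀ k (P : Fmˢ (suc (suc k))) → Valid (Comp k P)
comprehension k P σ = cast (tr-cong (Comp k P) λ ()) (allsˢ-valid k (λ {Γ} ν →
  -- `f` evaluates variable 0 of `P` at `a / y`; variable 1, the set `a` itself, is therefore
  -- supplied as the first parameter, ahead of those of the schema.
  ∀I (∃I (f P (v0 ,, params (λ l → there (ν (l ↑ˡ 0)))) v0) (∀I (cast (goal ν) (∧I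
    (⇒I (∃E (∈ᵒ-elim t-rootf h0) (∨E (unfold a-ηf (∧E₁ h0))
      (common-o-absurd h0)
      (∃E h0 (cut (≈-trans (≈-/-subst (∧E₁ h0) (∧E₂ h2)) f-i)
        (∧I (∈-intro (∧E₁ (∧E₂ (∧E₂ h1))) h0)
            (cast (sym (trans (cong (renF there) (renF-App P there)) (renF-App P there)))
              -- The edge provides `P` at `a / y`, while the claim concerns the given element, which
              -- is only `≈` to it.
              (App-resp P (≈-sym h0) (cast (body ν) (∧E₂ (∧E₂ (∧E₂ h1))))))))))))
    (⇒I (∃E (∈-elim (∧E₁ h0)) (∈ᵒ-intro {x = iᵐ v0} t-rootf
      (fold a-ηf (∨I₂ (∃I v0 (∧I ≐-refl (∧I ≐-refl (∧I (∧E₁ h0)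
        (cast (body' ν) (App-resp P (∧E₂ h0) (cast (renF-App P there) (∧E₂ h1))))))))))
      (≈-trans (∧E₂ h0) (≈-sym f-i))))))))))
  (λ ()))
  where
  module _ {Γ} (ν : Fin (k + 0) → Γ ∋ G) where
    e : Tm true (G ∷ Γ) G
    e = f P (v0 ,, params (λ l → there (ν (l ↑ˡ 0)))) v0
    ys : ∀ {s} → Tms true (s ∷ G ∷ G ∷ Γ) (replicate (suc k) G)
    ys = v2 ,, wTs (wTs (params (λ l → there (ν (l ↑ˡ 0)))))
    goal : (v0 ∈ᵍ w1 e ⇔ (v0 ∈ᵍ v1 ∧ App P (λ l → there (there (ν (l ↑ˡ 0)))) v1 v0)) ≡
      subF (liftS (e ▸_)) (tr (x0 ∈ˢ x1 ⇔ˢ (x0 ∈ˢ x2 ∧ˢ Rapp P (par 3) x2 x0)) (extG (extG (extG (λ l → var (ν l))))))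
    goal = cong (λ X → v0 ∈ᵍ w1 e ⇔ (v0 ∈ᵍ v1 ∧ X)) (sym (trans
      (cong (subF (liftS (e ▸_))) (tr-Rapp P (λ _ → refl)))
      (subF-App P (liftS (e ▸_)) (λ _ → refl))))
    body : tr P (fσ (ys {N}) v2) ≡ App P (λ l → there (there (there (there (ν (l ↑ˡ 0)))))) v3 (v3 / v0)
    body = tr-cong P λ { zero → refl ; (suc zero) → refl
                       ; (suc (suc l)) → cong w1 (lookupG-wTs-wTs-params _ l) }
    body' : App P (λ l → there (there (there (ν (l ↑ˡ 0))))) v2 (v2 / v0) ≡ tr P (fσ (ys {N}) v2) [ v0 ]
    body' = sym (subF-tr P λ { zero → refl ; (suc zero) → refl
                             ; (suc (suc l)) → cong (λ t → subT (v0 ▸_) (w1 t)) (lookupG-wTs-wTs-params _ l) })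

-- Strong extensionality

module _ {k} (Q : Fmˢ (suc (suc k))) where

  Simulation : ∀ {Γ} → (Fin k → Γ ∋ G) → Fm true Γ
  Simulation p = ∀[ G ] ∀[ G ] ∀[ G ]
    ((v1 ∈ᵍ v2 ∧ App Q (λ l → there (there (there (p l)))) v2 v0)
     ⇒ ∃[ G ] (v0 ∈ᵍ v1 ∧ App Q (λ l → there (there (there (there (p l))))) v2 v0))

  renF-Simulation : ∀ {Γ Δ} (r : Ren Γ Δ) {p} → renF r (Simulation p) ≡ Simulation (λ l → r (p l))
  renF-Simulation r = cong₂
    (λ X Y → ∀[ G ] ∀[ G ] ∀[ G ] ((v1 ∈ᵍ v2 ∧ X) ⇒ ∃[ G ] (v0 ∈ᵍ v1 ∧ Y)))
    (renF-App Q _) (renF-App Q _)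

  Simulation-elim : ∀ {Γ} {Hs : List (Fm true Γ)} {p c c' d} → Hs ⊢ᵐ Simulation p →
    Hs ⊢ᵐ c' ∈ᵍ c → Hs ⊢ᵐ App Q p c d → Hs ⊢ᵐ ∃[ G ] (v0 ∈ᵍ w1 d ∧ App Q (λ l → there (p l)) (w1 c') v0)
  Simulation-elim {c = c} {c'} {d} s m q =
    cast (cong (λ X → ∃[ G ] (v0 ∈ᵍ w1 d ∧ X)) (subF-App Q _ (λ _ → refl)))
      (⇒E (∀E* s (d ,, c' ,, c ,, ε)) (∧I m (cast (sym (subF-App Q _ (λ _ → refl))) q)))

  -- Closing `Q` under `≈` bridges a gap: the element of `d` supplied by `Simulation` is not itself
  -- of the form `b / y'`, but only `≈` to such a graph.
  Rel : ∀ {Γ} → (Fin k → Γ ∋ G) → (a b : Γ ∋ G) (x y : Tm true Γ N) → Fm true Γ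
  Rel p a b x y = ∃[ G ] ∃[ G ] (v1 ≈ w2 (var a) / w2 x ∧ v0 ≈ w2 (var b) / w2 y
    ∧ App Q (λ l → there (there (p l))) v1 v0)

  renF-Rel : ∀ {Γ Δ} (r : Ren Γ Δ) {p a b x y} →
    renF r (Rel p a b (var x) (var y)) ≡ Rel (λ l → r (p l)) (r a) (r b) (var (r x)) (var (r y))
  renF-Rel r = cong (λ X → ∃[ G ] ∃[ G ] (v1 ≈ _ ∧ v0 ≈ _ ∧ X)) (renF-App Q _)

  Rel-intro : ∀ {Γ} {Hs : List (Fm true Γ)} {p a b x y c d} → Hs ⊢ᵐ c ≈ var a / var x →
    Hs ⊢ᵐ d ≈ var b / var y → Hs ⊢ᵐ App Q p c d → Hs ⊢ᵐ Rel p a b (var x) (var y)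
  Rel-intro {c = c} {d} h h' q = ∃I c (∃I d (∧I
    (cast (cong (_≈ _) (sym (subT-▸-w1 c))) h)
    (∧I h' (cast (sym (trans (cong (subF _) (subF-App Q _ (λ _ → refl)))
      (trans (subF-App Q _ (λ _ → refl)) (cong (λ c → App Q _ c d) (subT-▸-w1 c))))) q))))

  Successor : ∀ {Γ} → (Fin k → Γ ∋ G) → (a b : Γ ∋ G) (x y : Γ ∋ N) → Fm true Γ
  Successor p a b x y = ∃[ N ] (η (w1 (var b)) v0 (w1 (var y))
    ∧ Rel (λ l → there (p l)) (there a) (there b) (var (there x)) v0)

  renF-Successor : ∀ {Γ Δ} (r : Ren Γ Δ) {p a b x y} →
    renF r (Successor p a b x y) ≡ Successor (λ l → r (p l)) (r a) (r b) (r x) (r y)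
  renF-Successor r {b = b} {y = y} = cong (λ X → ∃[ N ] (η (var (there (r b))) v0 (var (there (r y))) ∧ X)) (renF-Rel (liftR r))

  Successor-intro : ∀ {Γ} {Hs : List (Fm true Γ)} {p a b x y} (y' : Γ ∋ N) →
    Hs ⊢ᵐ η (var b) (var y') (var y) → Hs ⊢ᵐ Rel p a b (var x) (var y') → Hs ⊢ᵐ Successor p a b x y
  Successor-intro y' h q = ∃I (var y') (∧I h
    (cast (sym (cong (λ X → ∃[ G ] ∃[ G ] (v1 ≈ _ ∧ v0 ≈ _ ∧ X)) (subF-App Q _ (λ _ → refl)))) q))

  -- From `a / x' ∈ a / x ≈ c` and `Q c d`, the simulation yields some `d' ∈ d` with
  -- `Q (a / x') d'`; since `d ≈ b / y`, there is a child `y'` of `y` with `d' ≈ b / y'`.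
  Simulation-forth : ∀ {Γ} {Hs : List (Fm true Γ)} {p a b x x' y} → Hs ⊢ᵐ Simulation p →
    Hs ⊢ᵐ η (var a) (var x') (var x) → Hs ⊢ᵐ Rel p a b (var x) (var y) → Hs ⊢ᵐ Successor p a b x' y
  -- The premises enter as hypotheses through cuts, because the eliminations that follow extend the
  -- context: hypotheses are renamed along, derivations are not.
  Simulation-forth {x' = x'} s h q = ⇒E (⇒E (⇒E (⇒I (⇒I (⇒I
    (∃E h0 (∃E h0
      (∃E (Simulation-elim
            (cast (trans (cong (renF there) (renF-Simulation there)) (renF-Simulation there)) h4)
            (∈-respʳ (≈-sym (∧E₁ h0)) (∈/-intro {x = w2 (var x')} h3 ≈-/-refl))
            (∧E₂ (∧E₂ h0)))
        (∃E (∈/-elim (∈-respʳ (∧E₁ (∧E₂ h1)) (∧E₁ h0)))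
          (cast (sym (trans (cong (renF there) (trans (cong (renF there)
                        (trans (cong (renF there) (renF-Successor there)) (renF-Successor there)))
                      (renF-Successor there))) (renF-Successor there)))
            (Successor-intro here (∧E₁ h0)
              (Rel-intro ≈-/-refl (∧E₂ h0) (cast (renF-App Q there) (∧E₂ h1)))))))))))) s) h) q

  -- `Rel` as an index of `g'`. This is admissible because `tr` introduces neither `g` nor `g'`; the
  -- graphs `a`, `b` and the parameters are passed through their codes.
  relation-formula : Fm false (N ∷ N ∷ G ∷ G ∷ replicate k G)
  relation-formula = ∃[ G ] ∃[ G ] (v1 ≈ v4 / v2 ∧ v0 ≈ v5 / v3
    ∧ tr Q (appᵗ (λ l → var (there (there (there (there (there (there (finVar l)))))))) v1 v0))

  inst-relation-formula : ∀ {Γ} {p} {a b : Γ ∋ G} {x y} {ps : Tms true Γ (replicate k G)} →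
    (∀ l → lookupTms ps (finVar l) ≡ var (p l)) →
    inst relation-formula (x ,, y ,, var a ,, var b ,, ps) ≡ Rel p a b x y
  inst-relation-formula {a = a} {b} {x} {y} e =
    cong (λ X → ∃[ G ] ∃[ G ] (v1 ≈ w2 (var a) / w2 x ∧ v0 ≈ w2 (var b) / w2 y ∧ X)) (trans
    (cong (subF _) (embF-tr Q {υ = appᵗ (λ l → var (there (there (there (there (there (there (finVar l)))))))) v1 v0} λ { zero → refl ; (suc zero) → refl ; (suc (suc l)) → refl }))
    (subF-tr Q λ { zero → refl ; (suc zero) → refl ; (suc (suc l)) → cong w2 (e l) }))

-- The second condition of strong extensionality is the first one for the converse relation, so the
-- back clause of the bisimulation follows from `Simulation-forth`.
flip : ∀ {k} → Fmˢ (suc (suc k)) → Fmˢ (suc (suc k))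
flip = renˢ λ { zero → suc zero ; (suc zero) → zero ; (suc (suc l)) → suc (suc l) }

App-flip : ∀ {Γ k} (Q : Fmˢ (suc (suc k))) {p : Fin k → Γ ∋ G} {c d} → App (flip Q) p c d ≡ App Q p d c
App-flip Q = tr-renˢ Q λ { zero → refl ; (suc zero) → refl ; (suc (suc l)) → refl }

Rel-flip : ∀ {Γ k} {Hs : List (Fm true Γ)} (Q Q' : Fmˢ (suc (suc k))) {p a b x y} →
  (∀ {Γ} {p : Fin k → Γ ∋ G} {c d} → App Q p c d ≡ App Q' p d c) →
  Hs ⊢ᵐ Rel Q p a b (var x) (var y) → Hs ⊢ᵐ Rel Q' p b a (var y) (var x)
Rel-flip Q Q' e h = ∃E h (∃E h0
  (cast (sym (trans (cong (renF there) (renF-Rel Q' there)) (renF-Rel Q' there)))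
    (Rel-intro Q' (∧E₁ (∧E₂ h0)) (∧E₁ h0) (cast e (∧E₂ (∧E₂ h0))))))

Simulation-back : ∀ {Γ k} {Hs : List (Fm true Γ)} (Q : Fmˢ (suc (suc k))) {p a b x y y'} →
  Hs ⊢ᵐ Simulation (flip Q) p → Hs ⊢ᵐ η (var b) (var y') (var y) → Hs ⊢ᵐ Rel Q p a b (var x) (var y) →
  Hs ⊢ᵐ ∃[ N ] (η (w1 (var a)) v0 (w1 (var x)) ∧ Rel Q (λ l → there (p l)) (there a) (there b) v0 (var (there y')))
Simulation-back Q s h q =
  ∃-map (Simulation-forth (flip Q) s h (Rel-flip Q (flip Q) (sym (App-flip Q)) q))
    (∧I (∧E₁ h0) (Rel-flip (flip Q) Q (App-flip Q) (∧E₂ h0)))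

NG-replicate : ∀ k → NG (replicate k G)
NG-replicate zero = none
NG-replicate (suc k) = graph ⦃ NG-replicate k ⦄

lookupTms-params : ∀ {Γ k} (p : Fin k → Γ ∋ G) l → lookupTms (params p) (finVar l) ≡ var (p l)
lookupTms-params p zero = refl
lookupTms-params p (suc l) = lookupTms-params (λ l → p (suc l)) l

-- The relation "a / x and b / y are ≈ to graphs related by Q" is a bisimulation.
strong-extensionality : ∀ k (Q : Fmˢ (suc (suc k))) → Valid (SE k Q)
strong-extensionality k Q σ = cast (tr-cong (SE k Q) λ ()) (allsˢ-valid k (λ {Γ} ν →
  ∀I (∀I (cast (sym (goal ν)) (⇒I (conv
    (coinduction (relation-formula Q) ⦃ graph ⦃ graph ⦃ NG-replicate k ⦄ ⦄ ⦄ (var (there here) ,, var here ,, params (p ν))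
      (cast (sym (inst-relation-formula Q (lookupTms-params (p ν)))) (∃I v1 (∃I v0 (∧I ≈-/root (∧I ≈-/root (cast (start ν) (∧E₁ h0)))))))
      (cast (cong (λ X → ∃[ N ] (η v4 v0 v1 ∧ X)) (sym (inst-relation-formula Q (ps₄ ν))))
        (Simulation-forth Q (cast (simulation₃ ν Q) (∧E₁ (∧E₂ h1))) (∧E₁ h0) (cast (inst-relation-formula Q (ps₃ ν)) (∧E₂ h0))))
      (cast (cong (λ X → ∃[ N ] (η v5 v0 v1 ∧ X)) (sym (inst-relation-formula Q (ps₄ ν))))
        (Simulation-back Q (cast (simulation₃ ν (flip Q)) (∧E₂ (∧E₂ h1))) (∧E₁ h0) (cast (inst-relation-formula Q (ps₃ ν)) (∧E₂ h0)))))
    (≡ᵐ-sym ≈-≡ᵐ))))))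
  (λ ()))
  where
  module _ {Γ} (ν : Fin (k + 0) → Γ ∋ G) where
    p : Fin k → (G ∷ G ∷ Γ) ∋ G
    p l = there (there (ν (l ↑ˡ 0)))
    goal : tr ((Rapp Q (par 2) x1 x0
       ∧ˢ ∀ˢ (∀ˢ (∀ˢ ((x1 ∈ˢ x2 ∧ˢ Rapp Q (par 5) x2 x0)
                      ⇒ˢ ∃ˢ (x0 ∈ˢ x1 ∧ˢ Rapp Q (par 6) x2 x0))))
       ∧ˢ ∀ˢ (∀ˢ (∀ˢ ((x1 ∈ˢ x2 ∧ˢ Rapp Q (par 5) x0 x2)
                      ⇒ˢ ∃ˢ (x0 ∈ˢ x1 ∧ˢ Rapp Q (par 6) x0 x2)))))
     ⇒ˢ x1 ≐ˢ x0) (extG (extG (λ l → var (ν l)))) ≡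
      ((App Q p v1 v0 ∧ Simulation Q p ∧ Simulation (flip Q) p) ⇒ v1 ≈ v0)
    goal = cong₂ (λ X Y → (X ∧ Y) ⇒ v1 ≈ v0) (tr-Rapp Q λ _ → refl)
      (cong₂ _∧_
        (cong₂ simulation (tr-Rapp Q λ _ → refl) (tr-Rapp Q λ _ → refl))
        (cong₂ simulation
          (trans (tr-Rapp Q λ _ → refl) (sym (App-flip Q)))
          (trans (tr-Rapp Q λ _ → refl) (sym (App-flip Q)))))
      where
      simulation : Fm true (G ∷ G ∷ G ∷ G ∷ G ∷ Γ) → Fm true (G ∷ G ∷ G ∷ G ∷ G ∷ G ∷ Γ) → Fm true (G ∷ G ∷ Γ)
      simulation X Y = ∀[ G ] ∀[ G ] ∀[ G ] ((v1 ∈ᵍ v2 ∧ X) ⇒ ∃[ G ] (v0 ∈ᵍ v1 ∧ Y))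
    start : App Q p v1 v0 ≡ subF (v0 ▸_) (subF (liftS (v1 ▸_)) (App Q (λ l → there (there (p l))) v1 v0))
    start = sym (trans (cong (subF _) (subF-App Q _ (λ _ → refl))) (subF-App Q _ (λ _ → refl)))
    simulation₃ : ∀ Q' {s t u} → renF (there {t = s}) (renF (there {t = t}) (renF (there {t = u}) (Simulation Q' p))) ≡
      Simulation Q' (λ l → there (there (there (p l))))
    simulation₃ Q' = trans (cong (λ X → renF there (renF there X)) (renF-Simulation Q' there))
      (trans (cong (renF there) (renF-Simulation Q' there)) (renF-Simulation Q' there))
    params₃ : ∀ {s t u} → wTs {t = s} (wTs {t = t} (wTs {t = u} (params p))) ≡ params (λ l → there (there (there (p l))))
    params₃ = trans (cong (λ ts → wTs (wTs ts)) (renTs-params there p))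
      (trans (cong wTs (renTs-params there _)) (renTs-params there _))
    ps₃ : ∀ {s t u} l → lookupTms (wTs {t = s} (wTs {t = t} (wTs {t = u} (params p)))) (finVar l)
      ≡ var (there (there (there (p l))))
    ps₃ l = trans (cong (λ ts → lookupTms ts (finVar l)) params₃) (lookupTms-params _ l)
    ps₄ : ∀ {s t u v} l → lookupTms (wTs {t = s} (wTs {t = t} (wTs {t = u} (wTs {t = v} (params p))))) (finVar l)
      ≡ var (there (there (there (there (p l)))))
    ps₄ l = trans (cong (λ ts → lookupTms ts (finVar l)) (trans (cong wTs params₃) (renTs-params there _)))
      (lookupTms-params _ l)

-- Soundness of the translation

axiom-valid : ∀ {A} → Axiomˢ A → Valid A
axiom-valid ax-refl σ = ∀I ≈-refl
axiom-valid ax-eqtrans σ = ∀I (∀I (∀I (⇒I (≈-trans (≈-sym (∧E₁ h0)) (∧E₂ h0)))))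
axiom-valid ax-memL σ = ∀I (∀I (∀I (⇒I (∈-respˡ (∧E₁ h0) (∧E₂ h0)))))
axiom-valid ax-memR σ = ∀I (∀I (∀I (⇒I (∈-respʳ (∧E₁ h0) (∧E₂ h0)))))
axiom-valid (ax-ext k Q) = strong-extensionality k Q
axiom-valid ax-pair = pairing
axiom-valid ax-union = union
axiom-valid ax-power = powerset
axiom-valid (ax-comp k P) = comprehension k P
axiom-valid ax-inf = infinity
axiom-valid ax-tc = transitive-closure

trs : ∀ {Γ n} → List (Fmˢ n) → (Fin n → Tm true Γ G) → List (Fm true Γ)
trs Hs σ = map (λ H → tr H σ) Hs

tr-weaken : ∀ {Γ n} (A : Fmˢ n) (σ : Fin n → Tm true Γ G) → tr (renˢ suc A) (extG σ) ≡ renF there (tr A σ)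
tr-weaken A σ = trans (tr-renˢ A λ _ → refl) (sym (renF-tr A λ _ → refl))

trs-weaken : ∀ {Γ n} (Hs : List (Fmˢ n)) (σ : Fin n → Tm true Γ G) →
  trs (map (renˢ suc) Hs) (extG σ) ≡ wHs (trs Hs σ)
trs-weaken [] σ = refl
trs-weaken (H ∷ Hs) σ = cong₂ _∷_ (tr-weaken H σ) (trs-weaken Hs σ)

tr-[] : ∀ {Γ n} (A : Fmˢ (suc n)) (y : Fin n) (σ : Fin n → Tm true Γ G) →
  tr (A [ y ]ˢ) σ ≡ tr A (extG σ) [ σ y ]
tr-[] A y σ = trans (tr-renˢ A λ _ → refl)
  (sym (subF-tr A λ { zero → refl ; (suc k) → subT-▸-w1 (σ k) }))

-- The assignment is arbitrary, so the quantifier rules can extend it by `extG` and the axioms can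
-- restrict it along `from0`.
soundness : ∀ {Γ n Hs} {A : Fmˢ n} → Hs ⊢ˢ A → (σ : Fin n → Tm true Γ G) → trs Hs σ ⊢ᵐ tr A σ
soundness (hyp m) σ = hyp (∈-map⁺ (λ H → tr H σ) m)
soundness (ax {A = A} a) σ = cast (sym (tr-renˢ A λ _ → refl)) (axiom-valid a λ k → σ (from0 k))
soundness ⊤I σ = ⊤I
soundness (⊥E d) σ = ⊥E (soundness d σ)
soundness (∧I d e) σ = ∧I (soundness d σ) (soundness e σ)
soundness (∧E₁ d) σ = ∧E₁ (soundness d σ)
soundness (∧E₂ d) σ = ∧E₂ (soundness d σ)
soundness (∨I₁ d) σ = ∨I₁ (soundness d σ)
soundness (∨I₂ d) σ = ∨I₂ (soundness d σ)
soundness (∨E d e e') σ = ∨E (soundness d σ) (soundness e σ) (soundness e' σ)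
soundness (⇒I d) σ = ⇒I (soundness d σ)
soundness (⇒E d e) σ = ⇒E (soundness d σ) (soundness e σ)
soundness {Hs = Hs} (∀I {A = A} d) σ =
  ∀I (subst (_⊢ᵐ tr A (extG σ)) (trs-weaken Hs σ) (soundness d (extG σ)))
soundness (∀E {A = A} d y) σ = cast (sym (tr-[] A y σ)) (∀E (soundness d σ) (σ y))
soundness (∃I {A = A} y d) σ = ∃I (σ y) (cast (tr-[] A y σ) (soundness d σ))
soundness {Hs = Hs} (∃E {A = A} {D} d e) σ = ∃E (soundness d σ)
  (cast (tr-weaken D σ) (subst (λ Hs → (tr A (extG σ) ∷ Hs) ⊢ᵐ _) (trs-weaken Hs σ) (soundness e (extG σ))))

theorem1 : ∀ {n : ℕ} (P : Fmˢ n) → ZstProves P → ZmodProves (P †)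
-- The `m` auxiliary free variables of the given derivation become `m` fresh variables of sort `G`;
-- `vars` places them in front of the variables of `P †`.
theorem1 {n} P (m , d) = replicate m G , cast
  (trans (tr-renˢ P (vars-↑ʳ m)) (sym (renF-tr P λ _ → refl)))
  (soundness d (vars m))
  where
  vars : ∀ m → Fin (m + n) → Tm true (replicate m G ++ replicate n G) G
  vars zero k = var (finVar k)
  vars (suc m) = extG (vars m)
  vars-↑ʳ : ∀ m k → vars m (m ↑ʳ k) ≡ var (wkAll (replicate m G) (finVar k))
  vars-↑ʳ zero k = refl
  vars-↑ʳ (suc m) k = cong w1 (vars-↑ʳ m k)
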